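{- For all sufficiently large $n$, $ex(n,K_4,B_{4,2})\geq \frac{n^2}{12}-2$; moreover $ex(n,K_4,B_{4,2})\leq \frac{n^2}{9}+o(n^2)$ as $n\to\infty$.
   Context: $B_{4,2}$ denotes the graph consisting of two copies of $K_4$ that share exactly $2$ vertices. A graph is $F$-free if it contains no subgraph isomorphic to $F$. For graphs $T,F$, $ex(n,T,F)$ denotes the maximum number of copies of $T$ in an $F$-free graph on $n$ vertices. -}

module Defs where

open import Data.Nat using (ℕ; _+_; _*_; _<ᵇ_)
open import Data.Bool using (Bool; true; false; _∧_; if_then_else_)
open import Data.Fin using (Fin; toℕ; zero; suc)
open import Data.List using (List; allFin; concatMap; map)
open import Data.Nat.ListAction using (sum)
open import Data.Product using (Σ; _×_)
open import Function.Definitions using (Injective)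
open import Relation.Binary.PropositionalEquality using (_≡_)
open import Relation.Nullary using (¬_)

record Graph (n : ℕ) : Set where
  field
    adj   : Fin n → Fin n → Bool
    sym   : ∀ i j → adj i j ≡ adj j i
    irrefl : ∀ i → adj i i ≡ false

open Graph public

Edge : ∀ {n} → Graph n → Fin n → Fin n → Set
Edge G i j = adj G i j ≡ true

IsK4 : ∀ {n} → Graph n → Fin n → Fin n → Fin n → Fin n → Set
IsK4 G a b c d =
  Edge G a b × Edge G a c × Edge G a d × Edge G b c × Edge G b d × Edge G c d

k4ᵇ : ∀ {n} → Graph n → Fin n → Fin n → Fin n → Fin n → Bool
k4ᵇ G a b c d =
  (toℕ a <ᵇ toℕ b) ∧ (toℕ b <ᵇ toℕ c) ∧ (toℕ c <ᵇ toℕ d) ∧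
  adj G a b ∧ adj G a c ∧ adj G a d ∧ adj G b c ∧ adj G b d ∧ adj G c d

numK4 : ∀ {n} → Graph n → ℕ
numK4 {n} G =
  sum (concatMap (λ a → concatMap (λ b → concatMap (λ c →
    map (λ d → if k4ᵇ G a b c d then 1 else 0)
        (allFin n)) (allFin n)) (allFin n)) (allFin n))

-- B_{4,2}: two K4's sharing exactly 2 vertices. Vertices f 0, f 1 are shared,
-- {f0,f1,f2,f3} and {f0,f1,f4,f5} are K4's, and f is injective.
ContainsB42 : ∀ {n} → Graph n → Set
ContainsB42 {n} G =
  Σ (Fin 6 → Fin n) λ f →
    Injective _≡_ _≡_ f ×
    IsK4 G (f zero) (f (suc zero)) (f two) (f three) ×
    IsK4 G (f zero) (f (suc zero)) (f four) (f five)
  where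
  two three four five : Fin 6
  two = suc (suc zero)
  three = suc (suc (suc zero))
  four = suc (suc (suc (suc zero)))
  five = suc (suc (suc (suc (suc zero))))

B42Free : ∀ {n} → Graph n → Set
B42Free G = ¬ ContainsB42 G

-- Upper bound. Two K₄'s with a common edge share three vertices, so every K₄ abcd either lies in a K₅ or
-- has a "leaf" d: none of da, db, dc lies in another K₄. A vertex outside a K₅ sees at most two of its
-- vertices, so the five degrees add up to at most 2n + 10. A neighbour of a leaf d outside abcd sees at
-- most one of a, b, c, so deg a + deg b + deg c + 2 deg d ≤ 3n + 3. In the other direction, splitting each
-- edge among the K₄'s through it, deg v is at least the number of K₄'s at v, those with leaf v counted
-- three times. Weigh each incidence of v with a K₄ by deg v, twice if v is the leaf, and compare the two
-- bounds through the quadratic inequality u² ≥ n u - n²/4: there are at most (5/48) n² + O(n) K₄'s, which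
-- is below n²/9.
--
-- Lower bound. Join t disjoint triangles completely to an independent set of n - 3t vertices. Every K₄ is
-- a triangle plus an independent vertex, and 12 t (n - 3t) = n² - (n - 6t)² with |n - 6t| ≤ 4 for a
-- suitable t.
module Submission where

open import Defs hiding (sym)
open import Data.Bool using (Bool; true; false; _∧_; if_then_else_; not; T)
import Data.Bool as Bool
open import Data.Bool.Properties using (∧-comm; ∧-conicalˡ; ∧-conicalʳ)
open import Data.Empty using (⊥; ⊥-elim)
open import Data.Fin using (Fin; zero; suc; toℕ; splitAt; quotient; remainder; combine; _↑ˡ_; _↑ʳ_)
open import Data.Fin.Patterns using (0F; 1F; 2F)
open import Data.Fin.Properties using (_≟_; suc-injective; any?; pigeonhole; splitAt-↑ˡ; splitAt-↑ʳ;
  splitAt⁻¹-↑ˡ; toℕ-↑ˡ; toℕ-↑ʳ; toℕ-combine; toℕ<n; remQuot-combine; combine-remQuot;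
  combine-injectiveˡ; combine-injectiveʳ; ↑ˡ-injective; ↑ʳ-injective)
open import Data.List using (List; []; _∷_; allFin; concatMap; length; map; tabulate)
open import Data.List.Membership.Propositional using (_∈_)
open import Data.List.Properties using (map-tabulate)
open import Data.List.Relation.Unary.All using (All; []; _∷_)
open import Data.List.Relation.Unary.AllPairs using ([]; _∷_)
open import Data.List.Relation.Unary.Any using (here; there)
open import Data.List.Relation.Unary.Unique.Propositional using (Unique)
open import Data.Nat using (ℕ; zero; suc; _+_; _*_; _≤_; _<_; _<ᵇ_; _≤?_; _/_; _%_; z≤n; s≤s)
open import Data.Nat.DivMod using (m≡m%n+[m/n]*n; m%n<n)
import Data.Nat.ListAction as List
import Data.Nat.ListAction.Properties as List
open import Data.Nat.Properties hiding (_≟_; suc-injective)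
open import Data.Nat.Tactic.RingSolver using (solve-∀)
open import Data.Product using (Σ; ∃; _×_; _,_; proj₁; proj₂)
open import Data.Sum using (_⊎_; inj₁; inj₂)
open import Data.Unit using (tt)
open import Data.Vec using (lookup; []; _∷_)
open import Data.Vec.Relation.Unary.All using ([]; _∷_)
open import Data.Vec.Relation.Unary.AllPairs using ([]; _∷_)
open import Data.Vec.Relation.Unary.Unique.Propositional.Properties using (lookup-injective)
open import Function using (_∘_; case_of_; id)
open import Relation.Binary.PropositionalEquality
open import Relation.Nullary using (Dec; ¬_; does; yes; no; contradiction; ¬?)
open import Relation.Nullary.Decidable using (dec-true; dec-false; decidable-stable; _×-dec_)
open import Algebra.Properties.Semiring.Sum +-*-semiring
  using (sum; sum-cong-≗; ∑-comm; ∑-distrib-+; *-distribˡ-sum)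

-- Indicators and finite sums over `Fin n`.

𝟙 : Bool → ℕ
𝟙 true  = 1
𝟙 false = 0

if≡𝟙 : ∀ b → (if b then 1 else 0) ≡ 𝟙 b
if≡𝟙 true  = refl
if≡𝟙 false = refl

𝟙≤1 : ∀ b → 𝟙 b ≤ 1
𝟙≤1 true  = ≤-refl
𝟙≤1 false = z≤n

δ : ∀ {n} → Fin n → Fin n → ℕ
δ i j = 𝟙 (does (i ≟ j))

δ-refl : ∀ {n} (i : Fin n) → δ i i ≡ 1
δ-refl i with i ≟ i
... | yes _  = refl
... | no i≢i = contradiction refl i≢i

δ-≢ : ∀ {n} {i j : Fin n} → i ≢ j → δ i j ≡ 0
δ-≢ {i = i} {j} i≢j with i ≟ j
... | yes i≡j = contradiction i≡j i≢j
... | no _    = refl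

-- Opaque, so that the unifier can read off n and f from ∑ {n} f.
opaque

  ∑ : ∀ {n} → (Fin n → ℕ) → ℕ
  ∑ = sum

  ∑-cong : ∀ {n} {f g : Fin n → ℕ} → (∀ i → f i ≡ g i) → ∑ f ≡ ∑ g
  ∑-cong = sum-cong-≗

  ∑-+ : ∀ {n} (f g : Fin n → ℕ) → ∑ (λ i → f i + g i) ≡ ∑ f + ∑ g
  ∑-+ = ∑-distrib-+

  ∑-*ˡ : ∀ {n} k (f : Fin n → ℕ) → ∑ (λ i → k * f i) ≡ k * ∑ f
  ∑-*ˡ k f = sym (*-distribˡ-sum k f)

  ∑-swap : ∀ {m n} (f : Fin m → Fin n → ℕ) →
    ∑ (λ i → ∑ (λ j → f i j)) ≡ ∑ (λ j → ∑ (λ i → f i j))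
  ∑-swap = ∑-comm

  ∑-mono : ∀ {n} {f g : Fin n → ℕ} → (∀ i → f i ≤ g i) → ∑ f ≤ ∑ g
  ∑-mono {zero}  f≤g = z≤n
  ∑-mono {suc n} f≤g = +-mono-≤ (f≤g zero) (∑-mono (f≤g ∘ suc))

  ∑-const : ∀ n c → ∑ {n} (λ _ → c) ≡ n * c
  ∑-const zero    c = refl
  ∑-const (suc n) c = cong (c +_) (∑-const n c)

  ∑-zero : ∀ n → ∑ {n} (λ _ → 0) ≡ 0
  ∑-zero n = trans (∑-const n 0) (*-zeroʳ n)

  ∑-δ* : ∀ {n} (c : Fin n) (f : Fin n → ℕ) → ∑ (λ i → δ c i * f i) ≡ f c
  ∑-δ* {suc n} zero f = begin
    1 * f zero + ∑ {n} (λ _ → 0) ≡⟨ cong (1 * f zero +_) (∑-zero n) ⟩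
    1 * f zero + 0               ≡⟨ +-identityʳ _ ⟩
    1 * f zero                   ≡⟨ *-identityˡ _ ⟩
    f zero                       ∎
    where open ≡-Reasoning
  ∑-δ* {suc n} (suc c) f = trans (∑-cong (λ i → cong (_* f (suc i)) (δ-suc i))) (∑-δ* c (f ∘ suc))
    where
    δ-suc : ∀ i → δ (suc c) (suc i) ≡ δ c i
    δ-suc i with c ≟ i
    ... | yes _ = refl
    ... | no  _ = refl

  ∑-preimages≤1 : ∀ {m n} (g : Fin m → Fin n) → (∀ {i j} → g i ≡ g j → i ≡ j) →
    ∀ a → ∑ (λ q → δ (g q) a) ≤ 1
  ∑-preimages≤1 {zero}  g inj a = z≤n
  ∑-preimages≤1 {suc m} g inj a with g zero ≟ a
  ... | no  _    = ∑-preimages≤1 (g ∘ suc) (λ e → suc-injective (inj e)) a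
  ... | yes refl = ≤-reflexive (cong suc (trans (∑-cong {m} {g = λ _ → 0} (λ q → δ-≢ λ e → 0≢suc (inj e))) (∑-zero m)))
    where
    0≢suc : ∀ {q : Fin m} → Fin.suc q ≢ zero
    0≢suc ()

  sum-tabulate : ∀ {n} (f : Fin n → ℕ) → List.sum (tabulate f) ≡ ∑ f
  sum-tabulate {zero}  f = refl
  sum-tabulate {suc n} f = cong (f zero +_) (sum-tabulate (f ∘ suc))

∑-*ʳ : ∀ {n} (f : Fin n → ℕ) k → ∑ (λ i → f i * k) ≡ ∑ f * k
∑-*ʳ f k = trans (∑-cong (λ i → *-comm (f i) k)) (trans (∑-*ˡ k f) (*-comm k (∑ f)))

∑-δ : ∀ {n} (c : Fin n) → ∑ (δ c) ≡ 1
∑-δ c = trans (∑-cong (λ i → sym (*-identityʳ (δ c i)))) (∑-δ* c (λ _ → 1))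

-- Expanding `f (g q)` through `δ` and exchanging the sums gives each `f a` the number of preimages
-- of `a` as its coefficient, and that number is at most 1.
∑-injective : ∀ {m n} (g : Fin m → Fin n) → (∀ {i j} → g i ≡ g j → i ≡ j) →
  (f : Fin n → ℕ) → ∑ (f ∘ g) ≤ ∑ f
∑-injective g inj f = begin
  ∑ (λ q → f (g q))                    ≡⟨ ∑-cong (λ q → ∑-δ* (g q) f) ⟨
  ∑ (λ q → ∑ (λ a → δ (g q) a * f a))  ≡⟨ ∑-swap (λ q a → δ (g q) a * f a) ⟩
  ∑ (λ a → ∑ (λ q → δ (g q) a * f a))  ≡⟨ ∑-cong (λ a → ∑-*ʳ (λ q → δ (g q) a) (f a)) ⟩
  ∑ (λ a → ∑ (λ q → δ (g q) a) * f a)  ≤⟨ ∑-mono (λ a → *-monoˡ-≤ (f a) (∑-preimages≤1 g inj a)) ⟩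
  ∑ (λ a → 1 * f a)                    ≡⟨ ∑-cong (λ a → *-identityˡ (f a)) ⟩
  ∑ f                                  ∎
  where open ≤-Reasoning

term≤∑ : ∀ {n} (f : Fin n → ℕ) c → f c ≤ ∑ f
term≤∑ f c = begin
  f c                      ≡⟨ ∑-δ* c f ⟨
  ∑ (λ i → δ c i * f i)    ≤⟨ ∑-mono (λ i → *-monoˡ-≤ (f i) (𝟙≤1 (does (c ≟ i)))) ⟩
  ∑ (λ i → 1 * f i)        ≡⟨ ∑-cong (λ i → *-identityˡ (f i)) ⟩
  ∑ f                      ∎
  where open ≤-Reasoning

∑₄ : ∀ {n} → (Fin n → Fin n → Fin n → Fin n → ℕ) → ℕ
∑₄ f = ∑ λ a → ∑ λ b → ∑ λ c → ∑ λ d → f a b c d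

module _ {n} {f g : Fin n → Fin n → Fin n → Fin n → ℕ} where

  ∑₄-mono : (∀ a b c d → f a b c d ≤ g a b c d) → ∑₄ f ≤ ∑₄ g
  ∑₄-mono h = ∑-mono λ a → ∑-mono λ b → ∑-mono λ c → ∑-mono λ d → h a b c d

  ∑₄-cong : (∀ a b c d → f a b c d ≡ g a b c d) → ∑₄ f ≡ ∑₄ g
  ∑₄-cong h = ∑-cong λ a → ∑-cong λ b → ∑-cong λ c → ∑-cong λ d → h a b c d

module _ {n} (f g : Fin n → Fin n → Fin n → Fin n → ℕ) where

  ∑₄-+ : ∑₄ (λ a b c d → f a b c d + g a b c d) ≡ ∑₄ f + ∑₄ g
  ∑₄-+ = trans (∑-cong λ a → trans (∑-cong λ b → trans (∑-cong λ c →
    ∑-+ (f a b c) (g a b c)) (∑-+ _ _)) (∑-+ _ _)) (∑-+ _ _)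

module _ {n} (f : Fin n → Fin n → Fin n → Fin n → ℕ) where

  ∑₄-* : ∀ k → ∑₄ (λ a b c d → k * f a b c d) ≡ k * ∑₄ f
  ∑₄-* k = trans (∑-cong λ a → trans (∑-cong λ b → trans (∑-cong λ c →
    ∑-*ˡ k (f a b c)) (∑-*ˡ k _)) (∑-*ˡ k _)) (∑-*ˡ k _)

  ∑₄-swap₁₂ : ∑₄ f ≡ ∑₄ (λ a b c d → f b a c d)
  ∑₄-swap₁₂ = ∑-swap (λ a b → ∑ λ c → ∑ λ d → f a b c d)

  ∑₄-swap₂₃ : ∑₄ f ≡ ∑₄ (λ a b c d → f a c b d)
  ∑₄-swap₂₃ = ∑-cong λ a → ∑-swap (λ b c → ∑ λ d → f a b c d)

  ∑₄-swap₃₄ : ∑₄ f ≡ ∑₄ (λ a b c d → f a b d c)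
  ∑₄-swap₃₄ = ∑-cong λ a → ∑-cong λ b → ∑-swap (λ c d → f a b c d)

sum-map-allFin : ∀ {n} (f : Fin n → ℕ) → List.sum (map f (allFin n)) ≡ ∑ f
sum-map-allFin f = trans (cong List.sum (map-tabulate id f)) (sum-tabulate f)

sum-concatMap : ∀ {A : Set} (f : A → List ℕ) xs → List.sum (concatMap f xs) ≡ List.sum (map (List.sum ∘ f) xs)
sum-concatMap f []       = refl
sum-concatMap f (x ∷ xs) = trans (List.sum-++ (f x) (concatMap f xs)) (cong (List.sum (f x) +_) (sum-concatMap f xs))

sum-concatMap-allFin : ∀ {n} (f : Fin n → List ℕ) {g : Fin n → ℕ} → (∀ i → List.sum (f i) ≡ g i) →
  List.sum (concatMap f (allFin n)) ≡ ∑ g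
sum-concatMap-allFin {n} f {g} h =
  trans (sum-concatMap f (allFin n)) (trans (sum-map-allFin (List.sum ∘ f)) (∑-cong h))

numK4≡∑₄ : ∀ {n} (G : Graph n) → numK4 G ≡ ∑₄ (λ a b c d → 𝟙 (k4ᵇ G a b c d))
numK4≡∑₄ {n} G = sum-concatMap-allFin _ λ a → sum-concatMap-allFin _ λ b →
  sum-concatMap-allFin _ λ c →
  trans (sum-map-allFin _) (∑-cong λ d → if≡𝟙 (k4ᵇ G a b c d))

∑₃ : ∀ {n} → (Fin n → Fin n → Fin n → ℕ) → ℕ
∑₃ f = ∑ λ b → ∑ λ c → ∑ λ d → f b c d

∑₃-mono : ∀ {n} {f g : Fin n → Fin n → Fin n → ℕ} → (∀ b c d → f b c d ≤ g b c d) → ∑₃ f ≤ ∑₃ g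
∑₃-mono h = ∑-mono λ b → ∑-mono λ c → ∑-mono λ d → h b c d

∑₃-cong : ∀ {n} {f g : Fin n → Fin n → Fin n → ℕ} → (∀ b c d → f b c d ≡ g b c d) → ∑₃ f ≡ ∑₃ g
∑₃-cong h = ∑-cong λ b → ∑-cong λ c → ∑-cong λ d → h b c d

∑₃-+ : ∀ {n} (f g : Fin n → Fin n → Fin n → ℕ) → ∑₃ (λ b c d → f b c d + g b c d) ≡ ∑₃ f + ∑₃ g
∑₃-+ f g = trans (∑-cong λ b → trans (∑-cong λ c → ∑-+ (f b c) (g b c)) (∑-+ _ _)) (∑-+ _ _)

∑₃-*ˡ : ∀ {n} k (f : Fin n → Fin n → Fin n → ℕ) → ∑₃ (λ b c d → k * f b c d) ≡ k * ∑₃ f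
∑₃-*ˡ k f = trans (∑-cong λ b → trans (∑-cong λ c → ∑-*ˡ k (f b c)) (∑-*ˡ k _)) (∑-*ˡ k _)

-- Lets a pointwise inequality with many weighted terms be summed at once: either side is given as a
-- list of coefficients and functions.
∑₄-linear : ∀ {n} (fs : List (ℕ × (Fin n → Fin n → Fin n → Fin n → ℕ))) →
  ∑₄ (λ a b c d → List.sum (map (λ kf → proj₁ kf * proj₂ kf a b c d) fs)) ≡
  List.sum (map (λ kf → proj₁ kf * ∑₄ (proj₂ kf)) fs)
∑₄-linear {n} [] = trans (∑₄-cong {n} {g = λ _ _ _ _ → 0 * 0} λ _ _ _ _ → refl) (∑₄-* {n} (λ _ _ _ _ → 0) 0)
∑₄-linear ((k , f) ∷ fs) = trans (∑₄-+ (λ a b c d → k * f a b c d) _) (cong₂ _+_ (∑₄-* f k) (∑₄-linear fs))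

∑₅ : ∀ {n} → (Fin n → Fin n → Fin n → Fin n → Fin n → ℕ) → ℕ
∑₅ f = ∑₄ λ a b c d → ∑ λ x → f a b c d x

∑₅-rotate : ∀ {n} (f : Fin n → Fin n → Fin n → Fin n → Fin n → ℕ) → ∑₅ f ≡ ∑₅ (λ a b c d x → f x a b c d)
∑₅-rotate f = trans (∑₄-swap₁₂ _) (trans (∑₄-swap₂₃ _) (trans (∑₄-swap₃₄ _)
  (∑-cong λ a → ∑-cong λ b → ∑-cong λ c → ∑-swap (λ d x → f d a b c x))))

∑-map : ∀ {n} {A : Set} (f : A → Fin n → ℕ) xs →
  ∑ (λ y → List.sum (map (λ x → f x y) xs)) ≡ List.sum (map (λ x → ∑ (f x)) xs)
∑-map {n} f []       = ∑-zero n
∑-map     f (x ∷ xs) = trans (∑-+ (f x) _) (cong (∑ (f x) +_) (∑-map f xs))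

sum-map-1 : ∀ {A : Set} (f : A → ℕ) → (∀ x → f x ≡ 1) → ∀ xs → List.sum (map f xs) ≡ length xs
sum-map-1 f f≡1 []       = refl
sum-map-1 f f≡1 (x ∷ xs) = cong₂ _+_ (f≡1 x) (sum-map-1 f f≡1 xs)

-- Applied repeatedly to events that imply `t` and exclude one another, it bounds the sum of their
-- indicators by `𝟙 t`.
exclusive-+ : ∀ {p t r} → (p ≡ true → t ≡ true) → (p ≡ true → r ≤ 0) → r ≤ 𝟙 t → 𝟙 p + r ≤ 𝟙 t
exclusive-+ {true}  p⇒t p⇒r≡0 _ rewrite p⇒t refl = s≤s (p⇒r≡0 refl)
exclusive-+ {false} _   _     h = h

𝟙-mono : ∀ {p t} → (p ≡ true → t ≡ true) → 𝟙 p ≤ 𝟙 t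
𝟙-mono {true}  p⇒t rewrite p⇒t refl = ≤-refl
𝟙-mono {false} _ = z≤n

𝟙-none : ∀ {p} → (p ≡ true → ⊥) → 𝟙 p ≤ 0
𝟙-none {true}  ¬p = ⊥-elim (¬p refl)
𝟙-none {false} ¬p = z≤n

<ᵇ-true⇒< : ∀ {m n} → (m <ᵇ n) ≡ true → m < n
<ᵇ-true⇒< {m} {n} e = <ᵇ⇒< m n (subst T (sym e) tt)

<⇒<ᵇ-true : ∀ {m n} → m < n → (m <ᵇ n) ≡ true
<⇒<ᵇ-true {m} {n} m<n with m <ᵇ n | <⇒<ᵇ m<n
... | true | _ = refl

does⇒ : ∀ {P : Set} (P? : Dec P) → does P? ≡ true → P
does⇒ (yes p) _ = p

∧-true : ∀ {x y} → x ≡ true → y ≡ true → x ∧ y ≡ true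
∧-true refl refl = refl

true⇔⇒≡ : ∀ {x y} → (x ≡ true → y ≡ true) → (y ≡ true → x ≡ true) → x ≡ y
true⇔⇒≡ {true}  {_}     f g = sym (f refl)
true⇔⇒≡ {false} {true}  f g = g refl
true⇔⇒≡ {false} {false} f g = refl

-- Counting pairs against a list.

-- The multiplicity of `(y , z)` in the list, built from products of `δ` so that its sum over all
-- pairs is the length of the list.
occ : ∀ {n} → List (Fin n × Fin n) → Fin n → Fin n → ℕ
occ []             y z = 0
occ ((p , q) ∷ ps) y z = δ p y * δ q z + occ ps y z

∑∑-occ : ∀ {n} (ps : List (Fin n × Fin n)) → ∑ (λ y → ∑ (λ z → occ ps y z)) ≡ length ps
∑∑-occ {n} [] = trans (∑-cong {n} (λ _ → ∑-zero n)) (∑-zero n)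
∑∑-occ ((p , q) ∷ ps) = begin
  ∑ (λ y → ∑ (λ z → δ p y * δ q z + occ ps y z))
    ≡⟨ ∑-cong (λ y → trans (∑-+ (λ z → δ p y * δ q z) (occ ps y)) (cong (_+ ∑ (occ ps y)) (∑-*ˡ (δ p y) (δ q)))) ⟩
  ∑ (λ y → δ p y * ∑ (δ q) + ∑ (occ ps y))
    ≡⟨ ∑-+ (λ y → δ p y * ∑ (δ q)) (λ y → ∑ (occ ps y)) ⟩
  ∑ (λ y → δ p y * ∑ (δ q)) + ∑ (λ y → ∑ (occ ps y))
    ≡⟨ cong₂ _+_ (trans (∑-δ* p (λ _ → ∑ (δ q))) (∑-δ q)) (∑∑-occ ps) ⟩
  1 + length ps ∎
  where open ≡-Reasoning

∈⇒1≤occ : ∀ {n} {ps : List (Fin n × Fin n)} {y z} → (y , z) ∈ ps → 1 ≤ occ ps y z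
∈⇒1≤occ {y = y} {z} (here refl) rewrite δ-refl y | δ-refl z = s≤s z≤n
∈⇒1≤occ {ps = (p , q) ∷ _} {y} {z} (there yz∈ps) = ≤-trans (∈⇒1≤occ yz∈ps) (m≤n+m _ (δ p y * δ q z))

∉⇒occ≡0 : ∀ {n} (ps : List (Fin n × Fin n)) {y z} → All ((y , z) ≢_) ps → occ ps y z ≡ 0
∉⇒occ≡0 []             []         = refl
∉⇒occ≡0 ((p , q) ∷ ps) {y} {z} (yz≢ ∷ rest) with p ≟ y | q ≟ z
... | no _     | _        = ∉⇒occ≡0 ps rest
... | yes _    | no _     = ∉⇒occ≡0 ps rest
... | yes refl | yes refl = contradiction refl yz≢

module _ {n} (B : Fin n → Fin n → Bool) where

  count-≤-length : ∀ ps → (∀ y z → B y z ≡ true → (y , z) ∈ ps) → ∑ (λ y → ∑ (λ z → 𝟙 (B y z))) ≤ length ps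
  count-≤-length ps B⊆ps = ≤-trans (∑-mono λ y → ∑-mono λ z → bound y z) (≤-reflexive (∑∑-occ ps))
    where
    bound : ∀ y z → 𝟙 (B y z) ≤ occ ps y z
    bound y z with B y z in eq
    ... | true  = ∈⇒1≤occ (B⊆ps y z eq)
    ... | false = z≤n

  -- In a list without repetitions no multiplicity exceeds 1, so `occ` is at most the indicator of
  -- `B`.
  length-≤-count : ∀ ps → Unique ps → All (λ (y , z) → B y z ≡ true) ps → length ps ≤ ∑ (λ y → ∑ (λ z → 𝟙 (B y z)))
  length-≤-count ps uniq ps⊆B = ≤-trans (≤-reflexive (sym (∑∑-occ ps))) (∑-mono λ y → ∑-mono λ z → bound ps uniq ps⊆B y z)
    where
    bound : ∀ qs → Unique qs → All (λ (y , z) → B y z ≡ true) qs → ∀ y z → occ qs y z ≤ 𝟙 (B y z)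
    bound [] _ _ y z = z≤n
    bound ((p , q) ∷ qs) (fresh ∷ uqs) (Bpq ∷ Bqs) y z with p ≟ y | q ≟ z
    ... | no _     | _        = bound qs uqs Bqs y z
    ... | yes _    | no _     = bound qs uqs Bqs y z
    ... | yes refl | yes refl rewrite ∉⇒occ≡0 qs fresh | Bpq = ≤-refl

-- Boolean case checks and arithmetic.

-- The Booleans say which of the five vertices of a K₅ a further vertex sees. The trailing `+ 0` is
-- the end of the unfolded `List.sum`.
no-three⇒≤2 : ∀ p q r s t →
  (p ≡ true → q ≡ true → r ≢ true) → (p ≡ true → q ≡ true → s ≢ true) →
  (p ≡ true → q ≡ true → t ≢ true) → (p ≡ true → r ≡ true → s ≢ true) →
  (p ≡ true → r ≡ true → t ≢ true) → (p ≡ true → s ≡ true → t ≢ true) →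
  (q ≡ true → r ≡ true → s ≢ true) → (q ≡ true → r ≡ true → t ≢ true) →
  (q ≡ true → s ≡ true → t ≢ true) → (r ≡ true → s ≡ true → t ≢ true) →
  𝟙 p + (𝟙 q + (𝟙 r + (𝟙 s + (𝟙 t + 0)))) ≤ 2
no-three⇒≤2 true true true _ _ h _ _ _ _ _ _ _ _ _ = contradiction refl (h refl refl)
no-three⇒≤2 true true false true _ _ h _ _ _ _ _ _ _ _ = contradiction refl (h refl refl)
no-three⇒≤2 true true false false true _ _ h _ _ _ _ _ _ _ = contradiction refl (h refl refl)
no-three⇒≤2 true true false false false _ _ _ _ _ _ _ _ _ _ = ≤ᵇ⇒≤ _ _ _
no-three⇒≤2 true false true true _ _ _ _ h _ _ _ _ _ _ = contradiction refl (h refl refl)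
no-three⇒≤2 true false true false true _ _ _ _ h _ _ _ _ _ = contradiction refl (h refl refl)
no-three⇒≤2 true false true false false _ _ _ _ _ _ _ _ _ _ = ≤ᵇ⇒≤ _ _ _
no-three⇒≤2 true false false true true _ _ _ _ _ h _ _ _ _ = contradiction refl (h refl refl)
no-three⇒≤2 true false false true false _ _ _ _ _ _ _ _ _ _ = ≤ᵇ⇒≤ _ _ _
no-three⇒≤2 true false false false true _ _ _ _ _ _ _ _ _ _ = ≤ᵇ⇒≤ _ _ _
no-three⇒≤2 true false false false false _ _ _ _ _ _ _ _ _ _ = ≤ᵇ⇒≤ _ _ _
no-three⇒≤2 false true true true _ _ _ _ _ _ _ h _ _ _ = contradiction refl (h refl refl)
no-three⇒≤2 false true true false true _ _ _ _ _ _ _ h _ _ = contradiction refl (h refl refl)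
no-three⇒≤2 false true true false false _ _ _ _ _ _ _ _ _ _ = ≤ᵇ⇒≤ _ _ _
no-three⇒≤2 false true false true true _ _ _ _ _ _ _ _ h _ = contradiction refl (h refl refl)
no-three⇒≤2 false true false true false _ _ _ _ _ _ _ _ _ _ = ≤ᵇ⇒≤ _ _ _
no-three⇒≤2 false true false false true _ _ _ _ _ _ _ _ _ _ = ≤ᵇ⇒≤ _ _ _
no-three⇒≤2 false true false false false _ _ _ _ _ _ _ _ _ _ = ≤ᵇ⇒≤ _ _ _
no-three⇒≤2 false false true true true _ _ _ _ _ _ _ _ _ h = contradiction refl (h refl refl)
no-three⇒≤2 false false true true false _ _ _ _ _ _ _ _ _ _ = ≤ᵇ⇒≤ _ _ _
no-three⇒≤2 false false true false true _ _ _ _ _ _ _ _ _ _ = ≤ᵇ⇒≤ _ _ _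
no-three⇒≤2 false false true false false _ _ _ _ _ _ _ _ _ _ = ≤ᵇ⇒≤ _ _ _
no-three⇒≤2 false false false true true _ _ _ _ _ _ _ _ _ _ = ≤ᵇ⇒≤ _ _ _
no-three⇒≤2 false false false true false _ _ _ _ _ _ _ _ _ _ = ≤ᵇ⇒≤ _ _ _
no-three⇒≤2 false false false false true _ _ _ _ _ _ _ _ _ _ = ≤ᵇ⇒≤ _ _ _
no-three⇒≤2 false false false false false _ _ _ _ _ _ _ _ _ _ = ≤ᵇ⇒≤ _ _ _

-- `s` is adjacency to the leaf and counts twice. With `s` true at most one of the others holds, and
-- 1 + 2 = 3; with `s` false only the three others count.
one-beside⇒≤3 : ∀ p q r s →
  (s ≡ true → p ≡ true → q ≢ true) → (s ≡ true → p ≡ true → r ≢ true) →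
  (s ≡ true → q ≡ true → r ≢ true) →
  𝟙 p + (𝟙 q + (𝟙 r + (𝟙 s + (𝟙 s + 0)))) ≤ 3
one-beside⇒≤3 true  true  _     true  h _ _ = contradiction refl (h refl refl)
one-beside⇒≤3 true  false true  true  _ h _ = contradiction refl (h refl refl)
one-beside⇒≤3 false true  true  true  _ _ h = contradiction refl (h refl refl)
one-beside⇒≤3 true  false false true  _ _ _ = ≤ᵇ⇒≤ _ _ _
one-beside⇒≤3 false true  false true  _ _ _ = ≤ᵇ⇒≤ _ _ _
one-beside⇒≤3 false false true  true  _ _ _ = ≤ᵇ⇒≤ _ _ _
one-beside⇒≤3 false false false true  _ _ _ = ≤ᵇ⇒≤ _ _ _
one-beside⇒≤3 p     q     r     false _ _ _ = +-mono-≤ (𝟙≤1 p) (+-mono-≤ (𝟙≤1 q) (+-mono-≤ (𝟙≤1 r) z≤n))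

2xy≤x²+y² : ∀ x y → 2 * (x * y) ≤ x * x + y * y
2xy≤x²+y² x y with ≤-total x y
... | inj₁ x≤y with m≤n⇒∃[o]m+o≡n x≤y
...   | k , refl = subst (2 * (x * (x + k)) ≤_) (eq x k) (m≤m+n _ (k * k))
  where
  eq : ∀ x k → 2 * (x * (x + k)) + k * k ≡ x * x + (x + k) * (x + k)
  eq = solve-∀
2xy≤x²+y² x y | inj₂ y≤x with m≤n⇒∃[o]m+o≡n y≤x
...   | k , refl = subst (2 * ((y + k) * y) ≤_) (eq y k) (m≤m+n _ (k * k))
  where
  eq : ∀ y k → 2 * ((y + k) * y) + k * k ≡ (y + k) * (y + k) + y * y
  eq = solve-∀

-- With U = P + (7/5) Q, this is 6 d (P + Q) ≥ (P + 2 Q) (P + Q) ≥ U² ≥ 6 n U - 9 n².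
vertex-arith : ∀ n d P Q → P + 2 * Q ≤ 6 * d →
  2 * (n * (5 * P + 7 * Q)) ≤ 10 * (d * (P + Q)) + 15 * (n * n)
vertex-arith n d P Q h = *-cancelˡ-≤ 30 (begin
  30 * (2 * (n * V))                                      ≡⟨ eq₁ n V ⟩
  2 * (2 * (V * (15 * n)))                                ≤⟨ *-monoʳ-≤ 2 (2xy≤x²+y² V (15 * n)) ⟩
  2 * (V * V + 15 * n * (15 * n))                         ≤⟨ m≤m+n _ (10 * (P * Q) + 2 * (Q * Q)) ⟩
  2 * (V * V + 15 * n * (15 * n)) + (10 * (P * Q) + 2 * (Q * Q)) ≡⟨ eq₂ n P Q ⟩
  50 * ((P + 2 * Q) * (P + Q)) + 450 * (n * n)            ≤⟨ +-monoˡ-≤ _ (*-monoʳ-≤ 50 (*-monoˡ-≤ (P + Q) h)) ⟩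
  50 * (6 * d * (P + Q)) + 450 * (n * n)                  ≡⟨ eq₃ n d (P + Q) ⟩
  30 * (10 * (d * (P + Q)) + 15 * (n * n))                ∎)
  where
  open ≤-Reasoning
  V = 5 * P + 7 * Q
  eq₁ : ∀ n V → 30 * (2 * (n * V)) ≡ 2 * (2 * (V * (15 * n)))
  eq₁ = solve-∀
  eq₂ : ∀ n P Q → 2 * ((5 * P + 7 * Q) * (5 * P + 7 * Q) + 15 * n * (15 * n)) + (10 * (P * Q) + 2 * (Q * Q)) ≡
    50 * ((P + 2 * Q) * (P + Q)) + 450 * (n * n)
  eq₂ = solve-∀
  eq₃ : ∀ n d S → 50 * (6 * d * S) + 450 * (n * n) ≡ 30 * (10 * (d * S) + 15 * (n * n))
  eq₃ = solve-∀

-- `p`, `q`, `r`, `s` are the degrees in a K₄ whose leaf has degree `s`; `k`, `l`, `m` tell whether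
-- the others are leaves too. The leaf bound gives 5 · 3n = (8 + 7) n, and each further leaf costs
-- at most 5n, below the 7n allotted to it.
leaf-arith : ∀ n p q r s k l m → p + (q + (r + (s + (s + 0)))) ≤ n * 3 + 1 * 3 →
  p ≤ n → q ≤ n → r ≤ n →
  5 * (p * (1 + k) + (q * (1 + l) + (r * (1 + m) + s * 2))) ≤ n * (8 + 7 * (k + (l + (m + 1)))) + 40
leaf-arith n p q r s k l m h p≤n q≤n r≤n = begin
  5 * (p * (1 + k) + (q * (1 + l) + (r * (1 + m) + s * 2)))
    ≡⟨ eq₁ p q r s k l m ⟩
  5 * (p + (q + (r + (s + (s + 0))))) + 5 * (p * k + (q * l + r * m))
    ≤⟨ +-mono-≤ (*-monoʳ-≤ 5 h) (*-monoʳ-≤ 5 (+-mono-≤ (*-monoˡ-≤ k p≤n) (+-mono-≤ (*-monoˡ-≤ l q≤n) (*-monoˡ-≤ m r≤n)))) ⟩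
  5 * (n * 3 + 1 * 3) + 5 * (n * k + (n * l + n * m))
    ≤⟨ m≤m+n _ (2 * (n * (k + (l + m))) + 25) ⟩
  5 * (n * 3 + 1 * 3) + 5 * (n * k + (n * l + n * m)) + (2 * (n * (k + (l + m))) + 25)
    ≡⟨ eq₂ n k l m ⟩
  n * (8 + 7 * (k + (l + (m + 1)))) + 40 ∎
  where
  open ≤-Reasoning
  eq₁ : ∀ p q r s k l m → 5 * (p * (1 + k) + (q * (1 + l) + (r * (1 + m) + s * 2))) ≡
    5 * (p + (q + (r + (s + (s + 0))))) + 5 * (p * k + (q * l + r * m))
  eq₁ = solve-∀
  eq₂ : ∀ n k l m → 5 * (n * 3 + 1 * 3) + 5 * (n * k + (n * l + n * m)) + (2 * (n * (k + (l + m))) + 25) ≡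
    n * (8 + 7 * (k + (l + (m + 1)))) + 40
  eq₂ = solve-∀

-- `t` is the degree of the fifth vertex. Trading `p + q + r + s` for `4 * t` leaves four times the
-- sum of all five degrees, at most 4 (2n + 10) = 8n + 40.
K5-arith : ∀ n p q r s t k l m o → p + (q + (r + (s + (t + 0)))) ≤ n * 2 + 2 * 5 →
  p ≤ n → q ≤ n → r ≤ n → s ≤ n →
  5 * (p * (1 + k) + (q * (1 + l) + (r * (1 + m) + s * (1 + o)))) + 4 * t ≤
  n * (8 + 7 * (k + (l + (m + o)))) + 40 + (p + (q + (r + s)))
K5-arith n p q r s t k l m o h p≤n q≤n r≤n s≤n = begin
  5 * (p * (1 + k) + (q * (1 + l) + (r * (1 + m) + s * (1 + o)))) + 4 * t
    ≡⟨ eq₁ p q r s t k l m o ⟩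
  4 * (p + (q + (r + (s + (t + 0))))) + 5 * (p * k + (q * l + (r * m + s * o))) + (p + (q + (r + s)))
    ≤⟨ +-monoˡ-≤ _ (+-mono-≤ (*-monoʳ-≤ 4 h) (*-monoʳ-≤ 5
         (+-mono-≤ (*-monoˡ-≤ k p≤n) (+-mono-≤ (*-monoˡ-≤ l q≤n) (+-mono-≤ (*-monoˡ-≤ m r≤n) (*-monoˡ-≤ o s≤n)))))) ⟩
  4 * (n * 2 + 2 * 5) + 5 * (n * k + (n * l + (n * m + n * o))) + (p + (q + (r + s)))
    ≤⟨ +-monoˡ-≤ (p + (q + (r + s))) (m≤m+n (4 * (n * 2 + 2 * 5) + 5 * (n * k + (n * l + (n * m + n * o)))) (2 * (n * (k + (l + (m + o)))))) ⟩
  4 * (n * 2 + 2 * 5) + 5 * (n * k + (n * l + (n * m + n * o))) + 2 * (n * (k + (l + (m + o)))) + (p + (q + (r + s)))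
    ≡⟨ cong (_+ (p + (q + (r + s)))) (eq₂ n k l m o) ⟩
  n * (8 + 7 * (k + (l + (m + o)))) + 40 + (p + (q + (r + s))) ∎
  where
  open ≤-Reasoning
  eq₁ : ∀ p q r s t k l m o → 5 * (p * (1 + k) + (q * (1 + l) + (r * (1 + m) + s * (1 + o)))) + 4 * t ≡
    4 * (p + (q + (r + (s + (t + 0))))) + 5 * (p * k + (q * l + (r * m + s * o))) + (p + (q + (r + s)))
  eq₁ = solve-∀
  eq₂ : ∀ n k l m o → 4 * (n * 2 + 2 * 5) + 5 * (n * k + (n * l + (n * m + n * o))) + 2 * (n * (k + (l + (m + o)))) ≡
    n * (8 + 7 * (k + (l + (m + o)))) + 40
  eq₂ = solve-∀

-- For an edge whose K₄'s are counted with multiplicity 2 (as ordered completions), N is 2 for an edge in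
-- one K₄ and 6 for an edge of a K₅; the shares it hands out are 3 and 1.
share-of : ℕ → ℕ
share-of N = if does (N ≤? 2) then 3 else if does (N ≤? 6) then 1 else 0

share-of-≤2 : ∀ {N} → does (N ≤? 2) ≡ true → share-of N ≡ 3
share-of-≤2 {N} h rewrite h = refl

share-of-≤6 : ∀ {N} → N ≤ 6 → 1 ≤ share-of N
share-of-≤6 {N} N≤6 with does (N ≤? 2)
... | true  = s≤s z≤n
... | false rewrite dec-true (N ≤? 6) N≤6 = s≤s z≤n

*-share-of : ∀ N → N * share-of N ≤ 6
*-share-of N with does (N ≤? 2) in ≤2 | does (N ≤? 6) in ≤6
... | true  | _     = *-monoˡ-≤ 3 (does⇒ (N ≤? 2) ≤2)
... | false | true  = *-monoˡ-≤ 1 (does⇒ (N ≤? 6) ≤6)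
... | false | false = ≤-trans (≤-reflexive (*-zeroʳ N)) z≤n

-- Doubling the first bound gives 20 nM + 28 nΛ on the left; inserting the second for 20 Ω takes
-- away 8 nM + 28 nΛ. The coefficients are matched so that the leaf terms cancel.
combine-bounds : ∀ n M Λ Ω →
  2 * (n * (5 * M + 7 * Λ)) ≤ 10 * Ω + 15 * (n * (n * n)) →
  20 * Ω ≤ n * (8 * M + 28 * Λ) + 40 * M →
  12 * (n * M) ≤ 30 * (n * (n * n)) + 40 * M
combine-bounds n M Λ Ω h₁ h₂ = +-cancelˡ-≤ (n * (8 * M + 28 * Λ)) _ _ (begin
  n * (8 * M + 28 * Λ) + 12 * (n * M)                          ≡⟨ eq₁ n M Λ ⟩
  2 * (2 * (n * (5 * M + 7 * Λ)))                              ≤⟨ *-monoʳ-≤ 2 h₁ ⟩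
  2 * (10 * Ω + 15 * (n * (n * n)))                            ≡⟨ eq₂ Ω (n * (n * n)) ⟩
  20 * Ω + 30 * (n * (n * n))                                  ≤⟨ +-monoˡ-≤ _ h₂ ⟩
  n * (8 * M + 28 * Λ) + 40 * M + 30 * (n * (n * n))           ≡⟨ eq₃ (n * (8 * M + 28 * Λ)) (40 * M) _ ⟩
  n * (8 * M + 28 * Λ) + (30 * (n * (n * n)) + 40 * M)         ∎)
  where
  open ≤-Reasoning
  eq₁ : ∀ n M Λ → n * (8 * M + 28 * Λ) + 12 * (n * M) ≡ 2 * (2 * (n * (5 * M + 7 * Λ)))
  eq₁ = solve-∀
  eq₂ : ∀ Ω N → 2 * (10 * Ω + 15 * N) ≡ 20 * Ω + 30 * N
  eq₂ = solve-∀
  eq₃ : ∀ x y z → x + y + z ≡ x + (z + y)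
  eq₃ = solve-∀

-- For `80 ≤ n` the term `80 * M` is at most `n * M` and uses up one of 24 copies of `n * M`. Hence
-- 23 M ≤ 60 n², and with 552 = 23 · 24 the claim comes down to 540 ≤ 552.
numK4-arith : ∀ n M T → 80 ≤ n → 12 * (n * M) ≤ 30 * (n * (n * n)) + 40 * M → 24 * T ≤ M → 9 * T ≤ n * n
numK4-arith n@(suc _) M T 80≤n h 24T≤M = *-cancelˡ-≤ 552 (begin
  552 * (9 * T)       ≡⟨ eq₁ T ⟩
  9 * (23 * (24 * T)) ≤⟨ *-monoʳ-≤ 9 (*-monoʳ-≤ 23 24T≤M) ⟩
  9 * (23 * M)        ≤⟨ *-monoʳ-≤ 9 23M≤60n² ⟩
  9 * (60 * (n * n))  ≡⟨ *-assoc 9 60 (n * n) ⟨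
  540 * (n * n)       ≤⟨ *-monoˡ-≤ (n * n) (m≤m+n 540 12) ⟩
  552 * (n * n)       ∎)
  where
  open ≤-Reasoning
  eq₁ : ∀ T → 552 * (9 * T) ≡ 9 * (23 * (24 * T))
  eq₁ = solve-∀
  eq₂ : ∀ n M → n * M + n * (23 * M) ≡ 2 * (12 * (n * M))
  eq₂ = solve-∀
  eq₃ : ∀ n M → 2 * (30 * (n * (n * n)) + 40 * M) ≡ 80 * M + n * (60 * (n * n))
  eq₃ = solve-∀
  23M≤60n² : 23 * M ≤ 60 * (n * n)
  23M≤60n² = *-cancelˡ-≤ n (+-cancelˡ-≤ (n * M) _ _ (begin
    n * M + n * (23 * M)                  ≡⟨ eq₂ n M ⟩
    2 * (12 * (n * M))                    ≤⟨ *-monoʳ-≤ 2 h ⟩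
    2 * (30 * (n * (n * n)) + 40 * M)     ≡⟨ eq₃ n M ⟩
    80 * M + n * (60 * (n * n))           ≤⟨ +-monoˡ-≤ _ (*-monoˡ-≤ M 80≤n) ⟩
    n * M + n * (60 * (n * n))            ∎))

-- K₄'s and their symmetries, leaves, K₅'s.

module _ {n} (G : Graph n) where

  edge-sym : ∀ {a b} → Edge G a b → Edge G b a
  edge-sym {a} {b} ab = trans (Graph.sym G b a) ab

  edge⇒≢ : ∀ {a b} → Edge G a b → a ≢ b
  edge⇒≢ {a} ab refl with trans (sym ab) (irrefl G a)
  ... | ()

  swap₁₂ : ∀ {a b c d} → IsK4 G a b c d → IsK4 G b a c d
  swap₁₂ (ab , ac , ad , bc , bd , cd) = edge-sym ab , bc , bd , ac , ad , cd

  swap₂₃ : ∀ {a b c d} → IsK4 G a b c d → IsK4 G a c b d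
  swap₂₃ (ab , ac , ad , bc , bd , cd) = ac , ab , ad , edge-sym bc , cd , bd

  swap₃₄ : ∀ {a b c d} → IsK4 G a b c d → IsK4 G a b d c
  swap₃₄ (ab , ac , ad , bc , bd , cd) = ab , ad , ac , bd , bc , edge-sym cd

  k4 : Fin n → Fin n → Fin n → Fin n → Bool
  k4 a b c d = adj G a b ∧ adj G a c ∧ adj G a d ∧ adj G b c ∧ adj G b d ∧ adj G c d

  k4⇒IsK4 : ∀ {a b c d} → k4 a b c d ≡ true → IsK4 G a b c d
  k4⇒IsK4 = ∧⁶ _ _ _ _ _ _
    where
    ∧⁶ : ∀ p q r s t u → p ∧ q ∧ r ∧ s ∧ t ∧ u ≡ true →
      p ≡ true × q ≡ true × r ≡ true × s ≡ true × t ≡ true × u ≡ true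
    ∧⁶ true true true true true true refl = refl , refl , refl , refl , refl , refl

  IsK4⇒k4 : ∀ {a b c d} → IsK4 G a b c d → k4 a b c d ≡ true
  IsK4⇒k4 (ab , ac , ad , bc , bd , cd) =
    ∧-true ab (∧-true ac (∧-true ad (∧-true bc (∧-true bd cd))))

  k4-via : ∀ {a b c d a′ b′ c′ d′} → (IsK4 G a b c d → IsK4 G a′ b′ c′ d′) →
    (IsK4 G a′ b′ c′ d′ → IsK4 G a b c d) → k4 a b c d ≡ k4 a′ b′ c′ d′
  k4-via f g = true⇔⇒≡ (IsK4⇒k4 ∘ f ∘ k4⇒IsK4) (IsK4⇒k4 ∘ g ∘ k4⇒IsK4)

  deg : Fin n → ℕ
  deg a = ∑ λ x → 𝟙 (adj G a x)

  -- Counts ordered completions, so an edge lying in exactly one K₄ has K4-count 2.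
  K4-count : Fin n → Fin n → ℕ
  K4-count a b = ∑ λ c → ∑ λ d → 𝟙 (k4 a b c d)

  K4-count-sym : ∀ a b → K4-count a b ≡ K4-count b a
  K4-count-sym a b = ∑-cong λ c → ∑-cong λ d → cong 𝟙 (k4-via swap₁₂ swap₁₂)

  single : Fin n → Fin n → Bool
  single a b = does (K4-count a b ≤? 2)

  single-sym : ∀ {a b} → single a b ≡ true → single b a ≡ true
  single-sym {a} {b} t = subst (λ N → does (N ≤? 2) ≡ true) (K4-count-sym a b) t

  -- A different fourth vertex `x` would give three ordered completions `(c , d)`, `(d , c)`,
  -- `(c , x)` of `ab`, over the limit of 2.
  single⇒unique : ∀ {a b c d x} → single a b ≡ true → IsK4 G a b c d → IsK4 G a b c x → x ≡ d
  single⇒unique {a} {b} {c} {d} {x} s abcd abcx with x ≟ d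
  ... | yes x≡d = x≡d
  ... | no  x≢d = contradiction three (<⇒≱ (s≤s (does⇒ (K4-count a b ≤? 2) s)))
    where
    c≢d : c ≢ d
    c≢d = let (_ , _ , _ , _ , _ , cd) = abcd in edge⇒≢ cd
    three : 3 ≤ K4-count a b
    three = length-≤-count (k4 a b) ((c , d) ∷ (d , c) ∷ (c , x) ∷ [])
      (((c≢d ∘ cong proj₁) ∷ (x≢d ∘ sym ∘ cong proj₂) ∷ []) ∷ ((c≢d ∘ sym ∘ cong proj₁) ∷ []) ∷ [] ∷ [])
      (IsK4⇒k4 abcd ∷ IsK4⇒k4 (swap₃₄ abcd) ∷ IsK4⇒k4 abcx ∷ [])

  -- The edges from a to b, c and d lie in no K₄ other than abcd.
  leaf : Fin n → Fin n → Fin n → Fin n → Bool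
  leaf a b c d = single a b ∧ single a c ∧ single a d

  IsK5 : Fin n → Fin n → Fin n → Fin n → Fin n → Set
  IsK5 a b c d x = IsK4 G a b c d × Edge G a x × Edge G b x × Edge G c x × Edge G d x

  K5-rotate : ∀ {a b c d x} → IsK5 a b c d x → IsK5 b c d x a
  K5-rotate ((ab , ac , ad , bc , bd , cd) , ax , bx , cx , dx) =
    (bc , bd , bx , cd , cx , dx) , edge-sym ab , edge-sym ac , edge-sym ad , edge-sym ax

  K5-swap₁₂ : ∀ {a b c d x} → IsK5 a b c d x → IsK5 b a c d x
  K5-swap₁₂ (abcd , ax , bx , cx , dx) = swap₁₂ abcd , bx , ax , cx , dx

  K5-swap₂₃ : ∀ {a b c d x} → IsK5 a b c d x → IsK5 a c b d x
  K5-swap₂₃ (abcd , ax , bx , cx , dx) = swap₂₃ abcd , ax , cx , bx , dx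

  K5-swap₃₄ : ∀ {a b c d x} → IsK5 a b c d x → IsK5 a b d c x
  K5-swap₃₄ (abcd , ax , bx , cx , dx) = swap₃₄ abcd , ax , bx , dx , cx

-- Degree sums and the shapes of a K₄.

module _ {n} (G : Graph n) where

  deg-sum : List (Fin n) → ℕ
  deg-sum vs = List.sum (map (deg G) vs)

  -- Double counting: each `y` contributes the number of entries of `vs` adjacent to it, with
  -- repetition. An entry of `us` may exceed the general bound `k` by `m`.
  deg-sum-bound : ∀ vs us k m →
    (∀ y → List.sum (map (λ v → 𝟙 (adj G v y)) vs) ≤ k + m * List.sum (map (λ u → δ u y) us)) →
    deg-sum vs ≤ n * k + m * length us
  deg-sum-bound vs us k m h = begin
    deg-sum vs
      ≡⟨ ∑-map (λ v y → 𝟙 (adj G v y)) vs ⟨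
    ∑ (λ y → List.sum (map (λ v → 𝟙 (adj G v y)) vs))
      ≤⟨ ∑-mono h ⟩
    ∑ (λ y → k + m * List.sum (map (λ u → δ u y) us))
      ≡⟨ ∑-+ {n} (λ _ → k) _ ⟩
    ∑ {n} (λ _ → k) + ∑ (λ y → m * List.sum (map (λ u → δ u y) us))
      ≡⟨ cong₂ _+_ (∑-const n k) (trans (∑-*ˡ m _) (cong (m *_) (trans (∑-map δ us) (sum-map-1 _ ∑-δ us)))) ⟩
    n * k + m * length us ∎
    where open ≤-Reasoning

  deg≤n : ∀ a → deg G a ≤ n
  deg≤n a = ≤-trans (∑-mono (λ x → 𝟙≤1 (adj G a x))) (≤-reflexive (trans (∑-const n 1) (*-identityʳ n)))

  data Shape (a b c d : Fin n) : Set where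
    leaf₁ : leaf G a b c d ≡ true → Shape a b c d
    leaf₂ : leaf G b a c d ≡ true → Shape a b c d
    leaf₃ : leaf G c a b d ≡ true → Shape a b c d
    leaf₄ : leaf G d a b c ≡ true → Shape a b c d
    inK5  : ∀ x → IsK5 G a b c d x → Shape a b c d

-- Ordered against sorted K₄'s.

module _ {n} (G : Graph n) where

  -- Inserting one more vertex into the sorted part at a time, 24 splits as 4 · 3 · 2.
  opaque
    lt : Fin n → Fin n → Bool
    lt a b = toℕ a <ᵇ toℕ b

    chain₂ chain₃ chain₄ : Fin n → Fin n → Fin n → Fin n → Bool
    chain₂ a b c d = lt c d ∧ k4 G a b c d
    chain₃ a b c d = lt b c ∧ chain₂ a b c d
    chain₄ a b c d = lt a b ∧ chain₃ a b c d

    un₂ : ∀ {a b c d} → chain₂ a b c d ≡ true → toℕ c < toℕ d × IsK4 G a b c d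
    un₂ {a} {b} {c} {d} t = <ᵇ-true⇒< (∧-conicalˡ (lt c d) _ t) , k4⇒IsK4 G (∧-conicalʳ (lt c d) _ t)

    un₃ : ∀ {a b c d} → chain₃ a b c d ≡ true → toℕ b < toℕ c × toℕ c < toℕ d × IsK4 G a b c d
    un₃ {a} {b} {c} {d} t = <ᵇ-true⇒< (∧-conicalˡ (lt b c) _ t) , un₂ (∧-conicalʳ (lt b c) _ t)

    un₄ : ∀ {a b c d} → chain₄ a b c d ≡ true →
      toℕ a < toℕ b × toℕ b < toℕ c × toℕ c < toℕ d × IsK4 G a b c d
    un₄ {a} {b} {c} {d} t = <ᵇ-true⇒< (∧-conicalˡ (lt a b) _ t) , un₃ (∧-conicalʳ (lt a b) _ t)

    mk₂ : ∀ {a b c d} → toℕ c < toℕ d → IsK4 G a b c d → chain₂ a b c d ≡ true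
    mk₂ cd k = ∧-true (<⇒<ᵇ-true cd) (IsK4⇒k4 G k)

    mk₃ : ∀ {a b c d} → toℕ b < toℕ c → toℕ c < toℕ d → IsK4 G a b c d → chain₃ a b c d ≡ true
    mk₃ bc cd k = ∧-true (<⇒<ᵇ-true bc) (mk₂ cd k)

    -- Inside the opaque block `chain₄` unfolds to the conjunction that defines `k4ᵇ`.
    numK4≡∑₄-chain₄ : numK4 G ≡ ∑₄ λ a b c d → 𝟙 (chain₄ a b c d)
    numK4≡∑₄-chain₄ = numK4≡∑₄ G

  K4-tuples : ℕ
  K4-tuples = ∑₄ λ a b c d → 𝟙 (k4 G a b c d)

  24*numK4≤K4-tuples : 24 * numK4 G ≤ K4-tuples
  24*numK4≤K4-tuples = begin
    24 * numK4 G                       ≡⟨ cong (24 *_) numK4≡∑₄-chain₄ ⟩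
    24 * A₄                            ≡⟨ *-assoc 6 4 A₄ ⟩
    6 * (4 * A₄)                       ≤⟨ *-monoʳ-≤ 6 step₄ ⟩
    6 * A₃                             ≡⟨ *-assoc 2 3 A₃ ⟩
    2 * (3 * A₃)                       ≤⟨ *-monoʳ-≤ 2 step₃ ⟩
    2 * A₂                             ≤⟨ step₂ ⟩
    K4-tuples                          ∎
    where
    open ≤-Reasoning
    f₂ f₃ f₄ : Fin n → Fin n → Fin n → Fin n → ℕ
    f₂ a b c d = 𝟙 (chain₂ a b c d)
    f₃ a b c d = 𝟙 (chain₃ a b c d)
    f₄ a b c d = 𝟙 (chain₄ a b c d)
    A₂ = ∑₄ f₂
    A₃ = ∑₄ f₃
    A₄ = ∑₄ f₄
    step₂ : 2 * A₂ ≤ K4-tuples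
    step₂ = begin
      A₂ + (A₂ + 0)                             ≡⟨ cong (A₂ +_) (trans (+-identityʳ A₂) (∑₄-swap₃₄ f₂)) ⟩
      A₂ + ∑₄ (λ a b c d → f₂ a b d c)          ≡⟨ ∑₄-+ f₂ _ ⟨
      ∑₄ (λ a b c d → f₂ a b c d + f₂ a b d c)  ≤⟨ ∑₄-mono bound ⟩
      K4-tuples                                 ∎
      where
      bound : ∀ a b c d → f₂ a b c d + f₂ a b d c ≤ 𝟙 (k4 G a b c d)
      bound a b c d = exclusive-+ (IsK4⇒k4 G ∘ proj₂ ∘ un₂)
        (λ p → 𝟙-none λ q → <-asym (proj₁ (un₂ p)) (proj₁ (un₂ q)))
        (𝟙-mono (IsK4⇒k4 G ∘ swap₃₄ G ∘ proj₂ ∘ un₂))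
    step₃ : 3 * A₃ ≤ A₂
    step₃ = begin
      A₃ + (A₃ + (A₃ + 0))
        ≡⟨ cong₂ (λ x y → A₃ + (x + y)) (∑₄-swap₂₃ f₃)
             (trans (+-identityʳ A₃) (trans (∑₄-swap₃₄ f₃) (∑₄-swap₂₃ _))) ⟩
      A₃ + (∑₄ (λ a b c d → f₃ a c b d) + ∑₄ (λ a b c d → f₃ a c d b))
        ≡⟨ cong (A₃ +_) (∑₄-+ _ _) ⟨
      A₃ + ∑₄ (λ a b c d → f₃ a c b d + f₃ a c d b)
        ≡⟨ ∑₄-+ f₃ _ ⟨
      ∑₄ (λ a b c d → f₃ a b c d + (f₃ a c b d + f₃ a c d b))
        ≤⟨ ∑₄-mono bound ⟩
      A₂ ∎
      where
      bound : ∀ a b c d → f₃ a b c d + (f₃ a c b d + f₃ a c d b) ≤ f₂ a b c d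
      bound a b c d =
        exclusive-+ (λ p → let (_ , cd , k) = un₃ p in mk₂ cd k)
          (λ p → let (b<c , c<d , _) = un₃ p in
            +-mono-≤ (𝟙-none λ q → let (c<b , _) = un₃ q in <-asym b<c c<b)
                     (𝟙-none λ q → let (_ , d<b , _) = un₃ q in <-asym (<-trans b<c c<d) d<b))
          (exclusive-+ (λ p → let (c<b , b<d , k) = un₃ p in mk₂ (<-trans c<b b<d) (swap₂₃ G k))
            (λ p → let (_ , b<d , _) = un₃ p in 𝟙-none λ q → let (_ , d<b , _) = un₃ q in <-asym b<d d<b)
            (𝟙-mono λ p → let (c<d , _ , k) = un₃ p in mk₂ c<d (swap₂₃ G (swap₃₄ G k))))
    step₄ : 4 * A₄ ≤ A₃
    step₄ = begin
      A₄ + (A₄ + (A₄ + (A₄ + 0)))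
        ≡⟨ cong₂ (λ x y → A₄ + (x + y)) (∑₄-swap₁₂ f₄)
             (cong₂ _+_ (trans (∑₄-swap₂₃ f₄) (∑₄-swap₁₂ _))
               (trans (+-identityʳ A₄) (trans (∑₄-swap₃₄ f₄) (trans (∑₄-swap₂₃ _) (∑₄-swap₁₂ _))))) ⟩
      A₄ + (∑₄ (λ a b c d → f₄ b a c d) + (∑₄ (λ a b c d → f₄ b c a d) + ∑₄ (λ a b c d → f₄ b c d a)))
        ≡⟨ cong (λ x → A₄ + (∑₄ (λ a b c d → f₄ b a c d) + x)) (∑₄-+ _ _) ⟨
      A₄ + (∑₄ (λ a b c d → f₄ b a c d) + ∑₄ (λ a b c d → f₄ b c a d + f₄ b c d a))
        ≡⟨ cong (A₄ +_) (∑₄-+ _ _) ⟨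
      A₄ + ∑₄ (λ a b c d → f₄ b a c d + (f₄ b c a d + f₄ b c d a))
        ≡⟨ ∑₄-+ f₄ _ ⟨
      ∑₄ (λ a b c d → f₄ a b c d + (f₄ b a c d + (f₄ b c a d + f₄ b c d a)))
        ≤⟨ ∑₄-mono bound ⟩
      A₃ ∎
      where
      -- The summands insert `a` at the four places of `b < c < d`. Any two of these orders
      -- contradict each other, so `exclusive-+` applies.
      bound : ∀ a b c d → f₄ a b c d + (f₄ b a c d + (f₄ b c a d + f₄ b c d a)) ≤ f₃ a b c d
      bound a b c d =
        exclusive-+ (λ p → let (_ , b<c , c<d , k) = un₄ p in mk₃ b<c c<d k)
          (λ p → let (a<b , b<c , c<d , _) = un₄ p in
            +-mono-≤ (𝟙-none λ q → let (b<a , _) = un₄ q in <-asym a<b b<a)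
            (+-mono-≤ (𝟙-none λ q → let (_ , c<a , _) = un₄ q in <-asym (<-trans a<b b<c) c<a)
                      (𝟙-none λ q → let (_ , _ , d<a , _) = un₄ q in <-asym (<-trans a<b (<-trans b<c c<d)) d<a)))
        (exclusive-+ (λ p → let (b<a , a<c , c<d , k) = un₄ p in mk₃ (<-trans b<a a<c) c<d (swap₁₂ G k))
          (λ p → let (_ , a<c , c<d , _) = un₄ p in
            +-mono-≤ (𝟙-none λ q → let (_ , c<a , _) = un₄ q in <-asym a<c c<a)
                     (𝟙-none λ q → let (_ , _ , d<a , _) = un₄ q in <-asym (<-trans a<c c<d) d<a))
        (exclusive-+ (λ p → let (b<c , c<a , a<d , k) = un₄ p in
                        mk₃ b<c (<-trans c<a a<d) (swap₁₂ G (swap₂₃ G k)))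
          (λ p → let (_ , _ , a<d , _) = un₄ p in
            𝟙-none λ q → let (_ , _ , d<a , _) = un₄ q in <-asym a<d d<a)
        (𝟙-mono λ p → let (b<c , c<d , _ , k) = un₄ p in
           mk₃ b<c c<d (swap₁₂ G (swap₂₃ G (swap₃₄ G k))))))

-- Weights, edge shares and their symmetry.

module _ {n} (G : Graph n) where

  𝟙K4 𝟙leaf : Fin n → Fin n → Fin n → Fin n → ℕ
  𝟙K4 a b c d = 𝟙 (k4 G a b c d)
  𝟙leaf a b c d = 𝟙 (leaf G a b c d)

  edge-share : Fin n → Fin n → ℕ
  edge-share a b = share-of (K4-count G a b)

  𝟙K4-swap₁₂ : ∀ a b c d → 𝟙K4 a b c d ≡ 𝟙K4 b a c d
  𝟙K4-swap₁₂ a b c d = cong 𝟙 (k4-via G (swap₁₂ G) (swap₁₂ G))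

  𝟙K4-swap₂₃ : ∀ a b c d → 𝟙K4 a b c d ≡ 𝟙K4 a c b d
  𝟙K4-swap₂₃ a b c d = cong 𝟙 (k4-via G (swap₂₃ G) (swap₂₃ G))

  𝟙K4-swap₃₄ : ∀ a b c d → 𝟙K4 a b c d ≡ 𝟙K4 a b d c
  𝟙K4-swap₃₄ a b c d = cong 𝟙 (k4-via G (swap₃₄ G) (swap₃₄ G))

  -- `g` distinguishes its first argument, and the four functions let each vertex of a K₄ take that
  -- place. Renaming the summation variables preserves `𝟙K4`, so all four have the same total.
  module Symmetrize (g : Fin n → Fin n → Fin n → Fin n → ℕ) where

    first second third fourth : Fin n → Fin n → Fin n → Fin n → ℕ
    first  a b c d = 𝟙K4 a b c d * g a b c d
    second a b c d = 𝟙K4 a b c d * g b a c d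
    third  a b c d = 𝟙K4 a b c d * g c a b d
    fourth a b c d = 𝟙K4 a b c d * g d a b c

    ∑-second : ∑₄ second ≡ ∑₄ first
    ∑-second = sym (trans (∑₄-swap₁₂ first) (∑₄-cong λ a b c d → cong (_* g b a c d) (𝟙K4-swap₁₂ b a c d)))

    ∑-third : ∑₄ third ≡ ∑₄ first
    ∑-third = trans (sym (trans (∑₄-swap₂₃ second) (∑₄-cong λ a b c d → cong (_* g c a b d) (𝟙K4-swap₂₃ a c b d)))) ∑-second

    ∑-fourth : ∑₄ fourth ≡ ∑₄ first
    ∑-fourth = trans (sym (trans (∑₄-swap₃₄ third) (∑₄-cong λ a b c d → cong (_* g d a b c) (𝟙K4-swap₃₄ a b d c)))) ∑-third

  -- The ordered completions of an edge together receive at most 6 from it, by `*-share-of`; a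
  -- non-edge has no completions.
  K4-count≤6*adj : ∀ a b → K4-count G a b * edge-share a b ≤ 6 * 𝟙 (adj G a b)
  K4-count≤6*adj a b = by-adj _ refl
    where
    non-edge : adj G a b ≡ false → ∀ c d → 𝟙 (k4 G a b c d) ≡ 0
    non-edge ab c d rewrite ab = refl
    count≡0 : adj G a b ≡ false → K4-count G a b ≡ 0
    count≡0 ab = trans (∑-cong λ c → trans (∑-cong (non-edge ab c)) (∑-zero n)) (∑-zero n)
    by-adj : ∀ e → adj G a b ≡ e → K4-count G a b * edge-share a b ≤ 6 * 𝟙 e
    by-adj true  _  = *-share-of (K4-count G a b)
    by-adj false ab = ≤-reflexive (cong (_* edge-share a b) (count≡0 ab))

  single⇒edge-share≡3 : ∀ {a b} → single G a b ≡ true → edge-share a b ≡ 3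
  single⇒edge-share≡3 {a} {b} = share-of-≤2 {K4-count G a b}

  leaf⇒single₁ : ∀ {a b c d} → leaf G a b c d ≡ true → single G a b ≡ true
  leaf⇒single₁ {a} {b} = ∧-conicalˡ (single G a b) _

  weight : Fin n → Fin n → Fin n → Fin n → ℕ
  weight a b c d = deg G a * (1 + 𝟙leaf a b c d)

  K4s-at leaves-at : Fin n → ℕ
  K4s-at a    = ∑₃ (𝟙K4 a)
  leaves-at a = ∑₃ (λ b c d → 𝟙K4 a b c d * 𝟙leaf a b c d)

-- K₅'s with a distinguished fifth vertex.

module _ {n} (G : Graph n) where

  k5 : Fin n → Fin n → Fin n → Fin n → Fin n → Bool
  k5 a b c d x = k4 G a b c d ∧ adj G a x ∧ adj G b x ∧ adj G c x ∧ adj G d x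

  k5⇒IsK5 : ∀ {a b c d x} → k5 a b c d x ≡ true → IsK5 G a b c d x
  k5⇒IsK5 {a} {b} {c} {d} {x} t =
    let abcd , ax , bx , cx , dx = ∧⁵ (k4 G a b c d) (adj G a x) (adj G b x) (adj G c x) (adj G d x) t in
    k4⇒IsK4 G abcd , ax , bx , cx , dx
    where
    ∧⁵ : ∀ p q r s t → p ∧ q ∧ r ∧ s ∧ t ≡ true →
      p ≡ true × q ≡ true × r ≡ true × s ≡ true × t ≡ true
    ∧⁵ true true true true true refl = refl , refl , refl , refl , refl

  IsK5⇒k5 : ∀ {a b c d x} → IsK5 G a b c d x → k5 a b c d x ≡ true
  IsK5⇒k5 (abcd , ax , bx , cx , dx) = ∧-true (IsK4⇒k4 G abcd) (∧-true ax (∧-true bx (∧-true cx dx)))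

  𝟙K5 : Fin n → Fin n → Fin n → Fin n → Fin n → ℕ
  𝟙K5 a b c d x = 𝟙 (k5 a b c d x)

  𝟙K5-rotate : ∀ a b c d x → 𝟙K5 x a b c d ≡ 𝟙K5 a b c d x
  𝟙K5-rotate a b c d x = cong 𝟙 (true⇔⇒≡
    (IsK5⇒k5 ∘ K5-rotate G ∘ k5⇒IsK5)
    (IsK5⇒k5 ∘ K5-rotate G ∘ K5-rotate G ∘ K5-rotate G ∘ K5-rotate G ∘ k5⇒IsK5))

  -- The degree bound in a K₅ abcdx is symmetric in five vertices, but the weights of abcd see only four
  -- of them. Trading deg x for the average degree of a, b, c, d is free after summation, by rotation.
  Z₁ Z₂ Z₃ Z₄ Z₅ : Fin n → Fin n → Fin n → Fin n → ℕ
  Z₁ a b c d = ∑ λ x → 𝟙K5 a b c d x * deg G a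
  Z₂ a b c d = ∑ λ x → 𝟙K5 a b c d x * deg G b
  Z₃ a b c d = ∑ λ x → 𝟙K5 a b c d x * deg G c
  Z₄ a b c d = ∑ λ x → 𝟙K5 a b c d x * deg G d
  Z₅ a b c d = ∑ λ x → 𝟙K5 a b c d x * deg G x

  ∑Z₁ : ∑₄ Z₁ ≡ ∑₄ Z₅
  ∑Z₁ = trans (∑₅-rotate (λ a b c d x → 𝟙K5 a b c d x * deg G a))
    (∑₄-cong λ a b c d → ∑-cong λ x → cong (_* deg G x) (𝟙K5-rotate a b c d x))

  ∑Z₂ : ∑₄ Z₂ ≡ ∑₄ Z₅
  ∑Z₂ = trans (trans (∑₅-rotate (λ a b c d x → 𝟙K5 a b c d x * deg G b))
    (∑₄-cong λ a b c d → ∑-cong λ x → cong (_* deg G a) (𝟙K5-rotate a b c d x))) ∑Z₁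

  ∑Z₃ : ∑₄ Z₃ ≡ ∑₄ Z₅
  ∑Z₃ = trans (trans (∑₅-rotate (λ a b c d x → 𝟙K5 a b c d x * deg G c))
    (∑₄-cong λ a b c d → ∑-cong λ x → cong (_* deg G b) (𝟙K5-rotate a b c d x))) ∑Z₂

  ∑Z₄ : ∑₄ Z₄ ≡ ∑₄ Z₅
  ∑Z₄ = trans (trans (∑₅-rotate (λ a b c d x → 𝟙K5 a b c d x * deg G d))
    (∑₄-cong λ a b c d → ∑-cong λ x → cong (_* deg G c) (𝟙K5-rotate a b c d x))) ∑Z₃

  no-K5⇒∑≡0 : ∀ {a b c d} (f : Fin n → ℕ) → (∀ x → ¬ IsK5 G a b c d x) → ∑ (λ x → 𝟙K5 a b c d x * f x) ≡ 0
  no-K5⇒∑≡0 {a} {b} {c} {d} f no-K5 =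
    trans (∑-cong λ x → cong (_* f x) (n≤0⇒n≡0 (𝟙-none (no-K5 x ∘ k5⇒IsK5)))) (∑-zero n)

-- Structure of a `B42Free` graph.

module _ {n} (G : Graph n) (free : B42Free G) where

  private
    E : Fin n → Fin n → Set
    E = Edge G
    K : Fin n → Fin n → Fin n → Fin n → Set
    K = IsK4 G
    es : ∀ {a b} → E a b → E b a
    es = edge-sym G
    e≢ : ∀ {a b} → E a b → a ≢ b
    e≢ = edge⇒≢ G

  -- The four assumed inequalities concern the pairs that no edge of the two K₄'s joins; all other
  -- pairs are distinct because adjacent.
  B42-clash : ∀ {a b c d e f} → K a b c d → K a b e f → c ≢ e → c ≢ f → d ≢ e → d ≢ f → ⊥
  B42-clash {a} {b} {c} {d} {e} {f} abcd@(ab , ac , ad , bc , bd , cd) abef@(_ , ae , af , be , bf , ef) c≢e c≢f d≢e d≢f =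
    free (lookup vs , (λ {i} {j} → lookup-injective distinct i j) , abcd , abef)
    where
    vs = a ∷ b ∷ c ∷ d ∷ e ∷ f ∷ []
    distinct = (edge⇒≢ G ab ∷ edge⇒≢ G ac ∷ edge⇒≢ G ad ∷ edge⇒≢ G ae ∷ edge⇒≢ G af ∷ [])
             ∷ (edge⇒≢ G bc ∷ edge⇒≢ G bd ∷ edge⇒≢ G be ∷ edge⇒≢ G bf ∷ [])
             ∷ (edge⇒≢ G cd ∷ c≢e ∷ c≢f ∷ [])
             ∷ (d≢e ∷ d≢f ∷ [])
             ∷ (edge⇒≢ G ef ∷ [])
             ∷ [] ∷ []

  meet-again : ∀ {a b c d e f} → K a b c d → K a b e f → (e ≡ c ⊎ e ≡ d) ⊎ (f ≡ c ⊎ f ≡ d)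
  meet-again {a} {b} {c} {d} {e} {f} abcd abef with e ≟ c | e ≟ d | f ≟ c | f ≟ d
  ... | yes p | _     | _     | _     = inj₁ (inj₁ p)
  ... | no _  | yes p | _     | _     = inj₁ (inj₂ p)
  ... | no _  | no _  | yes p | _     = inj₂ (inj₁ p)
  ... | no _  | no _  | no _  | yes p = inj₂ (inj₂ p)
  ... | no p  | no q  | no r  | no s  = ⊥-elim (B42-clash abcd abef (p ∘ sym) (r ∘ sym) (q ∘ sym) (s ∘ sym))

  -- Otherwise `abcy` and `abdx` share exactly `a` and `b`. This yields both the degree bound for a
  -- K₅ and the uniqueness of the fifth vertex over a K₄.
  K5-extra≡ : ∀ {a b c d x y} → IsK5 G a b c d x → E a y → E b y → E c y → y ≢ d → y ≡ x
  K5-extra≡ {a} {b} {c} {d} {x} {y} (abcd@(ab , ac , ad , bc , bd , cd) , ax , bx , cx , dx) ay by cy y≢d with y ≟ x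
  ... | yes y≡x = y≡x
  ... | no  y≢x = ⊥-elim (B42-clash (ab , ac , ay , bc , by , cy) (ab , ad , ax , bd , bx , dx)
                    (edge⇒≢ G cd) (edge⇒≢ G cx) y≢d y≢x)

  -- A K₄ `abyz` has to meet each of the pairs `cd`, `cx`, `dx`, so `y` and `z` are both among `c`,
  -- `d`, `x`. The list holds the six ordered pairs.
  K5-count : ∀ {a b c d x} → IsK5 G a b c d x → K4-count G a b ≤ 6
  K5-count {a} {b} {c} {d} {x} k5@(abcd@(ab , ac , ad , bc , bd , cd) , ax , bx , cx , dx) =
    count-≤-length (k4 G a b) ((c , d) ∷ (d , c) ∷ (c , x) ∷ (x , c) ∷ (d , x) ∷ (x , d) ∷ [])
      λ y z t → pick y z (k4⇒IsK4 G t)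
    where
    pick : ∀ y z → K a b y z →
      (y , z) ∈ ((c , d) ∷ (d , c) ∷ (c , x) ∷ (x , c) ∷ (d , x) ∷ (x , d) ∷ [])
    pick y z abyz with meet-again abcd abyz
    ... | inj₁ (inj₁ refl) with meet-again (ab , ad , ax , bd , bx , dx) abyz
    ...   | inj₁ (inj₁ c≡d)  = contradiction c≡d (edge⇒≢ G cd)
    ...   | inj₁ (inj₂ c≡x)  = contradiction c≡x (edge⇒≢ G cx)
    ...   | inj₂ (inj₁ refl) = here refl
    ...   | inj₂ (inj₂ refl) = there (there (here refl))
    pick y z abyz | inj₁ (inj₂ refl) with meet-again (ab , ac , ax , bc , bx , cx) abyz
    ...   | inj₁ (inj₁ d≡c)  = contradiction (sym d≡c) (edge⇒≢ G cd)
    ...   | inj₁ (inj₂ d≡x)  = contradiction d≡x (edge⇒≢ G dx)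
    ...   | inj₂ (inj₁ refl) = there (here refl)
    ...   | inj₂ (inj₂ refl) = there (there (there (there (here refl))))
    pick y z abyz | inj₂ (inj₁ refl) with meet-again (ab , ad , ax , bd , bx , dx) abyz
    ...   | inj₁ (inj₁ refl) = there (here refl)
    ...   | inj₁ (inj₂ refl) = there (there (there (here refl)))
    ...   | inj₂ (inj₁ c≡d)  = contradiction c≡d (edge⇒≢ G cd)
    ...   | inj₂ (inj₂ c≡x)  = contradiction c≡x (edge⇒≢ G cx)
    pick y z abyz | inj₂ (inj₂ refl) with meet-again (ab , ac , ax , bc , bx , cx) abyz
    ...   | inj₁ (inj₁ refl) = here refl
    ...   | inj₁ (inj₂ refl) = there (there (there (there (there (here refl)))))
    ...   | inj₂ (inj₁ d≡c)  = contradiction (sym d≡c) (edge⇒≢ G cd)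
    ...   | inj₂ (inj₂ d≡x)  = contradiction d≡x (edge⇒≢ G dx)

  -- The hypotheses say that each triangle of `abcd` at `d` lies in no further K₄. By `meet-again`,
  -- another K₄ on an edge at `d` would contain such a triangle.
  leaf-intro : ∀ {a b c d} → K a b c d →
    (∀ {z} → E a z → E b z → E d z → z ≡ c) →
    (∀ {z} → E a z → E c z → E d z → z ≡ b) →
    (∀ {z} → E b z → E c z → E d z → z ≡ a) →
    leaf G d a b c ≡ true
  leaf-intro {a} {b} {c} {d} abcd hc hb ha =
    ∧-true (single-intro dabc (λ dz az bz → hc az bz dz) (λ dz az cz → hb az cz dz))
    (∧-true (single-intro (swap₂₃ G dabc) (λ dz bz az → hc az bz dz) (λ dz bz cz → ha bz cz dz))
            (single-intro (swap₂₃ G (swap₃₄ G dabc)) (λ dz cz az → hb az cz dz) (λ dz cz bz → ha bz cz dz)))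
    where
    dabc : K d a b c
    dabc = swap₁₂ G (swap₂₃ G (swap₃₄ G abcd))
    single-intro : ∀ {p q r s} → K p q r s → (∀ {z} → E p z → E q z → E r z → z ≡ s) →
      (∀ {z} → E p z → E q z → E s z → z ≡ r) → single G p q ≡ true
    single-intro {p} {q} {r} {s} pqrs hs hr = dec-true (K4-count G p q ≤? 2)
      (count-≤-length (k4 G p q) ((r , s) ∷ (s , r) ∷ []) λ y z t → pick y z (k4⇒IsK4 G t))
      where
      pick : ∀ y z → K p q y z → (y , z) ∈ ((r , s) ∷ (s , r) ∷ [])
      pick y z pqyz@(_ , py , pz , qy , qz , yz) with meet-again pqrs pqyz
      ... | inj₁ (inj₁ refl) = here (cong (r ,_) (hs pz qz yz))
      ... | inj₁ (inj₂ refl) = there (here (cong (s ,_) (hr pz qz yz)))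
      ... | inj₂ (inj₁ refl) = there (here (cong (_, r) (hs py qy (es yz))))
      ... | inj₂ (inj₂ refl) = here (cong (_, s) (hr py qy (es yz)))

  -- If `dx` is an edge, the five vertices form a K₅. Otherwise a second K₄ on a triangle at `d`,
  -- say `abdz`, would share exactly `ab` with the K₄ `abcx`; here `z ≢ x` because `d` is adjacent
  -- to `z` but not to `x`.
  extend : ∀ {a b c d x} → K a b c d → x ≢ d → E a x → E b x → E c x →
    leaf G d a b c ≡ true ⊎ IsK5 G a b c d x
  extend {a} {b} {c} {d} {x} abcd@(ab , ac , ad , bc , bd , cd) x≢d ax bx cx with adj G d x in dx
  ... | true  = inj₂ (abcd , ax , bx , cx , refl)
  ... | false = inj₁ (leaf-intro abcd
    (λ az bz dz → dec-stable λ z≢c → B42-clash (ab , az , ad , bz , bd , es dz) (ab , ac , ax , bc , bx , cx)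
      z≢c (≢x dz) (e≢ (es cd)) (x≢d ∘ sym))
    (λ az cz dz → dec-stable λ z≢b → B42-clash (ac , az , ad , cz , cd , es dz) (ac , ab , ax , es bc , cx , bx)
      z≢b (≢x dz) (e≢ (es bd)) (x≢d ∘ sym))
    (λ bz cz dz → dec-stable λ z≢a → B42-clash (bc , bz , bd , cz , cd , es dz) (bc , es ab , bx , es ac , cx , ax)
      z≢a (≢x dz) (e≢ (es ad)) (x≢d ∘ sym)))
    where
    dec-stable : ∀ {y z : Fin n} → (y ≢ z → ⊥) → y ≡ z
    dec-stable {y} {z} = decidable-stable (y ≟ z)
    ≢x : ∀ {z} → E d z → z ≢ x
    ≢x dz refl = contradiction (trans (sym dz) dx) λ ()

  -- Looks for a second K₄ on one of the triangles `abd`, `acd`, `bcd`. If there is one, `extend`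
  -- makes the vertex opposite the triangle a leaf or finds a K₅; if there is none, `d` is a leaf.
  shape-of : ∀ {a b c d} → K a b c d → Shape G a b c d
  shape-of {a} {b} {c} {d} abcd
    with another? a b d c | another? a c d b | another? b c d a
    where
    another? : ∀ p q r s → Dec (∃ λ x → x ≢ s × E p x × E q x × E r x)
    another? p q r s = any? λ x → ¬? (x ≟ s) ×-dec (adj G p x Bool.≟ true) ×-dec (adj G q x Bool.≟ true) ×-dec (adj G r x Bool.≟ true)
  ... | yes (x , x≢c , ax , bx , dx) | _ | _ with extend (swap₃₄ G abcd) x≢c ax bx dx
  ...   | inj₁ l  = leaf₃ l
  ...   | inj₂ k5 = inK5 x (K5-swap₃₄ G k5)
  shape-of abcd | no _ | yes (x , x≢b , ax , cx , dx) | _ with extend (swap₃₄ G (swap₂₃ G abcd)) x≢b ax cx dx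
  ...   | inj₁ l  = leaf₂ l
  ...   | inj₂ k5 = inK5 x (K5-swap₂₃ G (K5-swap₃₄ G k5))
  shape-of abcd | no _ | no _ | yes (x , x≢a , bx , cx , dx) with extend (swap₃₄ G (swap₂₃ G (swap₁₂ G abcd))) x≢a bx cx dx
  ...   | inj₁ l  = leaf₁ l
  ...   | inj₂ k5 = inK5 x (K5-swap₁₂ G (K5-swap₂₃ G (K5-swap₃₄ G k5)))
  shape-of {a} {b} {c} {d} abcd | no ¬c | no ¬b | no ¬a = leaf₄ (leaf-intro abcd
    (λ az bz dz → decidable-stable (_ ≟ c) λ z≢c → ¬c (_ , z≢c , az , bz , dz))
    (λ az cz dz → decidable-stable (_ ≟ b) λ z≢b → ¬b (_ , z≢b , az , cz , dz))
    (λ bz cz dz → decidable-stable (_ ≟ a) λ z≢a → ¬a (_ , z≢a , bz , cz , dz)))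

  -- Any two of `a`, `b`, `c` include `a` or `b`, so a second K₄ on a triangle at `d` would be a
  -- second K₄ on the edge `da` or `db`.
  leaf-unique : ∀ {a b c d} → K a b c d → leaf G d a b c ≡ true →
    (∀ {y} → E d y → E a y → E b y → y ≡ c) ×
    (∀ {y} → E d y → E a y → E c y → y ≡ b) ×
    (∀ {y} → E d y → E b y → E c y → y ≡ a)
  leaf-unique {a} {b} {c} {d} (ab , ac , ad , bc , bd , cd) l =
      (λ dy ay by → single⇒unique G da (es ad , es bd , es cd , ab , ac , bc) (es ad , es bd , dy , ab , ay , by))
    , (λ dy ay cy → single⇒unique G da (es ad , es cd , es bd , ac , ab , es bc) (es ad , es cd , dy , ac , ay , cy))
    , (λ dy by cy → single⇒unique G db (es bd , es cd , es ad , bc , es ab , es ac) (es bd , es cd , dy , bc , by , cy))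
    where
    da = ∧-conicalˡ (single G d a) _ l
    db = ∧-conicalˡ (single G d b) _ (∧-conicalʳ (single G d a) _ l)

  -- Each of `a`, `b`, `c` sees the two others and the leaf, counted twice: 4 = 3 + 1. The vertex
  -- `d` itself falls under the last case, since it is not its own neighbour.
  leaf-degrees : ∀ {a b c d} → K a b c d → leaf G d a b c ≡ true →
    deg-sum G (a ∷ b ∷ c ∷ d ∷ d ∷ []) ≤ n * 3 + 1 * 3
  leaf-degrees {a} {b} {c} {d} abcd l =
    deg-sum-bound G (a ∷ b ∷ c ∷ d ∷ d ∷ []) (a ∷ b ∷ c ∷ []) 3 1 bound
    where
    u = leaf-unique abcd l
    bound : ∀ y → List.sum (map (λ v → 𝟙 (adj G v y)) (a ∷ b ∷ c ∷ d ∷ d ∷ [])) ≤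
                  3 + 1 * List.sum (map (λ u → δ u y) (a ∷ b ∷ c ∷ []))
    loop : ∀ {v} → 𝟙 (adj G v v) ≤ 0
    loop {v} = ≤-reflexive (cong 𝟙 (irrefl G v))
    bound y with a ≟ y | b ≟ y | c ≟ y
    ... | yes refl | _ | _ =
      ≤-trans (+-mono-≤ loop (+-mono-≤ (𝟙≤1 (adj G b y)) (+-mono-≤ (𝟙≤1 (adj G c y)) (+-mono-≤ (𝟙≤1 (adj G d y)) (+-mono-≤ (𝟙≤1 (adj G d y)) z≤n)))))
              (+-monoʳ-≤ 3 (*-monoʳ-≤ 1 {1} (s≤s z≤n)))
    ... | no _ | yes refl | _ =
      ≤-trans (+-mono-≤ (𝟙≤1 (adj G a y)) (+-mono-≤ loop (+-mono-≤ (𝟙≤1 (adj G c y)) (+-mono-≤ (𝟙≤1 (adj G d y)) (+-mono-≤ (𝟙≤1 (adj G d y)) z≤n)))))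
              (+-monoʳ-≤ 3 (*-monoʳ-≤ 1 {1} (s≤s z≤n)))
    ... | no _ | no _ | yes refl =
      ≤-trans (+-mono-≤ (𝟙≤1 (adj G a y)) (+-mono-≤ (𝟙≤1 (adj G b y)) (+-mono-≤ loop (+-mono-≤ (𝟙≤1 (adj G d y)) (+-mono-≤ (𝟙≤1 (adj G d y)) z≤n)))))
              (+-monoʳ-≤ 3 (*-monoʳ-≤ 1 {1} (s≤s z≤n)))
    ... | no a≢y | no b≢y | no c≢y = one-beside⇒≤3 (adj G a y) (adj G b y) (adj G c y) (adj G d y)
      (λ dy ay by → c≢y (sym (proj₁ u dy ay by)))
      (λ dy ay cy → b≢y (sym (proj₁ (proj₂ u) dy ay cy)))
      (λ dy by cy → a≢y (sym (proj₂ (proj₂ u) dy by cy)))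

  -- A vertex of the K₅ sees four of the five, 2 + 2. An outside vertex that saw three would have to
  -- be one of the other two, by `K5-extra≡`.
  K5-degrees : ∀ {a b c d x} → IsK5 G a b c d x →
    deg-sum G (a ∷ b ∷ c ∷ d ∷ x ∷ []) ≤ n * 2 + 2 * 5
  K5-degrees {a} {b} {c} {d} {x} k5 =
    deg-sum-bound G (a ∷ b ∷ c ∷ d ∷ x ∷ []) (a ∷ b ∷ c ∷ d ∷ x ∷ []) 2 2 bound
    where
    bound : ∀ y → List.sum (map (λ v → 𝟙 (adj G v y)) (a ∷ b ∷ c ∷ d ∷ x ∷ [])) ≤
                  2 + 2 * List.sum (map (λ u → δ u y) (a ∷ b ∷ c ∷ d ∷ x ∷ []))
    loop : ∀ {v} → 𝟙 (adj G v v) ≤ 0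
    loop {v} = ≤-reflexive (cong 𝟙 (irrefl G v))
    bound y with a ≟ y | b ≟ y | c ≟ y | d ≟ y | x ≟ y
    ... | yes refl | _ | _ | _ | _ =
      ≤-trans (+-mono-≤ loop (+-mono-≤ (𝟙≤1 (adj G b y)) (+-mono-≤ (𝟙≤1 (adj G c y)) (+-mono-≤ (𝟙≤1 (adj G d y)) (+-mono-≤ (𝟙≤1 (adj G x y)) z≤n)))))
              (+-monoʳ-≤ 2 (*-monoʳ-≤ 2 {1} (s≤s z≤n)))
    ... | no _ | yes refl | _ | _ | _ =
      ≤-trans (+-mono-≤ (𝟙≤1 (adj G a y)) (+-mono-≤ loop (+-mono-≤ (𝟙≤1 (adj G c y)) (+-mono-≤ (𝟙≤1 (adj G d y)) (+-mono-≤ (𝟙≤1 (adj G x y)) z≤n)))))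
              (+-monoʳ-≤ 2 (*-monoʳ-≤ 2 {1} (s≤s z≤n)))
    ... | no _ | no _ | yes refl | _ | _ =
      ≤-trans (+-mono-≤ (𝟙≤1 (adj G a y)) (+-mono-≤ (𝟙≤1 (adj G b y)) (+-mono-≤ loop (+-mono-≤ (𝟙≤1 (adj G d y)) (+-mono-≤ (𝟙≤1 (adj G x y)) z≤n)))))
              (+-monoʳ-≤ 2 (*-monoʳ-≤ 2 {1} (s≤s z≤n)))
    ... | no _ | no _ | no _ | yes refl | _ =
      ≤-trans (+-mono-≤ (𝟙≤1 (adj G a y)) (+-mono-≤ (𝟙≤1 (adj G b y)) (+-mono-≤ (𝟙≤1 (adj G c y)) (+-mono-≤ loop (+-mono-≤ (𝟙≤1 (adj G x y)) z≤n)))))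
              (+-monoʳ-≤ 2 (*-monoʳ-≤ 2 {1} (s≤s z≤n)))
    ... | no _ | no _ | no _ | no _ | yes refl =
      ≤-trans (+-mono-≤ (𝟙≤1 (adj G a y)) (+-mono-≤ (𝟙≤1 (adj G b y)) (+-mono-≤ (𝟙≤1 (adj G c y)) (+-mono-≤ (𝟙≤1 (adj G d y)) (+-mono-≤ loop z≤n)))))
              ≤-refl
    ... | no a≢y | no b≢y | no c≢y | no d≢y | no x≢y =
      -- Rotation brings each of the ten triples to the front, with `σ` applied where the triple is
      -- not cyclically consecutive.
      no-three⇒≤2 (adj G a y) (adj G b y) (adj G c y) (adj G d y) (adj G x y)
        (λ ay by cy → x≢y (sym (K5-extra≡ abcdx ay by cy (d≢y ∘ sym))))
        (λ ay by dy → x≢y (sym (K5-extra≡ (σ abcdx) ay by dy (c≢y ∘ sym))))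
        (λ ay by xy → d≢y (sym (K5-extra≡ xabcd xy ay by (c≢y ∘ sym))))
        (λ ay cy dy → b≢y (sym (K5-extra≡ (σ cdxab) cy dy ay (x≢y ∘ sym))))
        (λ ay cy xy → d≢y (sym (K5-extra≡ (σ xabcd) xy ay cy (b≢y ∘ sym))))
        (λ ay dy xy → c≢y (sym (K5-extra≡ dxabc dy xy ay (b≢y ∘ sym))))
        (λ by cy dy → a≢y (sym (K5-extra≡ bcdxa by cy dy (x≢y ∘ sym))))
        (λ by cy xy → a≢y (sym (K5-extra≡ (σ bcdxa) by cy xy (d≢y ∘ sym))))
        (λ by dy xy → c≢y (sym (K5-extra≡ (σ dxabc) dy xy by (a≢y ∘ sym))))
        (λ cy dy xy → b≢y (sym (K5-extra≡ cdxab cy dy xy (a≢y ∘ sym))))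
      where
      σ : ∀ {p q r s t} → IsK5 G p q r s t → IsK5 G p q s r t
      σ = K5-swap₃₄ G
      abcdx = k5
      bcdxa = K5-rotate G abcdx
      cdxab = K5-rotate G bcdxa
      dxabc = K5-rotate G cdxab
      xabcd = K5-rotate G dxabc

  -- By `K5-extra≡` the fifth vertex is unique, so the indicator is `δ x`.
  K5⇒∑≡ : ∀ {a b c d x} (f : Fin n → ℕ) → IsK5 G a b c d x → ∑ (λ y → 𝟙K5 G a b c d y * f y) ≡ f x
  K5⇒∑≡ {a} {b} {c} {d} {x} f abcdx = trans (∑-cong λ y → cong (_* f y) (𝟙K5≡δ y)) (∑-δ* x f)
    where
    𝟙K5≡δ : ∀ y → 𝟙K5 G a b c d y ≡ δ x y
    𝟙K5≡δ y with x ≟ y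
    ... | yes refl = cong 𝟙 (IsK5⇒k5 G abcdx)
    ... | no x≢y   = n≤0⇒n≡0 (𝟙-none λ t → let (_ , ay , by , cy , dy) = k5⇒IsK5 G t in
      x≢y (sym (K5-extra≡ abcdx ay by cy (edge⇒≢ G dy ∘ sym))))

  K5⇒edge-share≥1 : ∀ {a b c d x} → IsK5 G a b c d x → 1 ≤ edge-share G a b
  K5⇒edge-share≥1 {a} {b} k5 = share-of-≤6 {K4-count G a b} (K5-count k5)

  -- If `a` is a leaf, its three edges give 3 · 3 = 3 + 6. If another vertex is a leaf, its edge to
  -- `a` alone gives 3. In a K₅ every edge gives at least 1.
  edge-shares-bound : ∀ {a b c d} → IsK4 G a b c d → 3 + 6 * 𝟙leaf G a b c d ≤ edge-share G a b + edge-share G a c + edge-share G a d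
  edge-shares-bound {a} {b} {c} {d} abcd = by-leaf _ refl
    where
    p = edge-share G a b
    q = edge-share G a c
    r = edge-share G a d
    by-leaf : ∀ e → leaf G a b c d ≡ e → 3 + 6 * 𝟙 e ≤ p + q + r
    by-leaf true l = ≤-reflexive (sym (cong₂ _+_ (cong₂ _+_
      (single⇒edge-share≡3 G (∧-conicalˡ (single G a b) _ l))
      (single⇒edge-share≡3 G (∧-conicalˡ (single G a c) _ (∧-conicalʳ (single G a b) _ l))))
      (single⇒edge-share≡3 G (∧-conicalʳ (single G a c) _ (∧-conicalʳ (single G a b) _ l)))))
    by-leaf false ¬l with shape-of abcd
    ... | leaf₁ l = contradiction (trans (sym l) ¬l) λ ()
    ... | leaf₂ l = begin
      3         ≡⟨ single⇒edge-share≡3 G (single-sym G (leaf⇒single₁ G l)) ⟨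
      p         ≤⟨ m≤m+n p q ⟩
      p + q     ≤⟨ m≤m+n (p + q) r ⟩
      p + q + r ∎
      where open ≤-Reasoning
    ... | leaf₃ l = begin
      3         ≡⟨ single⇒edge-share≡3 G (single-sym G (leaf⇒single₁ G l)) ⟨
      q         ≤⟨ m≤n+m q p ⟩
      p + q     ≤⟨ m≤m+n (p + q) r ⟩
      p + q + r ∎
      where open ≤-Reasoning
    ... | leaf₄ l = begin
      3         ≡⟨ single⇒edge-share≡3 G (single-sym G (leaf⇒single₁ G l)) ⟨
      r         ≤⟨ m≤n+m r (p + q) ⟩
      p + q + r ∎
      where open ≤-Reasoning
    ... | inK5 x k = +-mono-≤ (+-mono-≤ (K5⇒edge-share≥1 k) (K5⇒edge-share≥1 (K5-swap₂₃ G k)))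
      (K5⇒edge-share≥1 (K5-swap₂₃ G (K5-swap₃₄ G k)))

  -- `x` would complete the triangle `abd` as `c` does, and so be equal to its neighbour `c`.
  leaf∉K5 : ∀ {a b c d x} → IsK4 G a b c d → leaf G d a b c ≡ true →
    Edge G a x → Edge G b x → Edge G c x → Edge G d x → ⊥
  leaf∉K5 abcd l ax bx cx dx = edge⇒≢ G cx (sym (proj₁ (leaf-unique abcd l) dx ax bx))

  -- In the leaf cases no K₅ contains `abcd`, so `Z₅` vanishes and the other `Z`'s only enlarge the
  -- right side. In the K₅ case the `Z`'s collapse to single degrees and `K5-arith` applies.
  weight-bound : ∀ {a b c d} → IsK4 G a b c d →
    5 * (weight G a b c d + (weight G b a c d + (weight G c a b d + weight G d a b c))) + 4 * Z₅ G a b c d ≤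
    n * (8 + 7 * (𝟙leaf G a b c d + (𝟙leaf G b a c d + (𝟙leaf G c a b d + 𝟙leaf G d a b c)))) + 40 +
    (Z₁ G a b c d + (Z₂ G a b c d + (Z₃ G a b c d + Z₄ G a b c d)))
  weight-bound {a} {b} {c} {d} abcd = by-shape (shape-of abcd)
    where
    α = 𝟙leaf G a b c d
    β = 𝟙leaf G b a c d
    γ = 𝟙leaf G c a b d
    η = 𝟙leaf G d a b c
    wa = weight G a b c d
    wb = weight G b a c d
    wc = weight G c a b d
    wd = weight G d a b c
    swap-last : ∀ x y z w → x + (y + (z + w)) ≡ x + (y + (w + z))
    swap-last = solve-∀
    second-last : ∀ x y z w → x + (y + (z + w)) ≡ x + (z + (w + y))
    second-last = solve-∀
    first-last : ∀ x y z w → x + (y + (z + w)) ≡ y + (z + (w + x))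
    first-last = solve-∀
    -- The leaf is passed as the last vertex `s`. The values `k`, `l`, `m` stay free because other
    -- vertices may be leaves as well.
    from-leaf : ∀ {p q r s} k l m {o ω Λ} → IsK4 G p q r s → leaf G s p q r ≡ true →
      (∀ x → ¬ IsK5 G a b c d x) → o ≡ 1 →
      ω ≡ deg G p * (1 + k) + (deg G q * (1 + l) + (deg G r * (1 + m) + deg G s * (1 + o))) →
      Λ ≡ k + (l + (m + o)) →
      5 * ω + 4 * Z₅ G a b c d ≤ n * (8 + 7 * Λ) + 40 +
        (Z₁ G a b c d + (Z₂ G a b c d + (Z₃ G a b c d + Z₄ G a b c d)))
    from-leaf {p} {q} {r} {s} k l m pqrs s-leaf no-K5 refl refl refl = begin
      5 * ω + 4 * Z₅ G a b c d    ≡⟨ cong (λ z → 5 * ω + 4 * z) (no-K5⇒∑≡0 G (deg G) no-K5) ⟩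
      5 * ω + 0                   ≡⟨ +-identityʳ (5 * ω) ⟩
      5 * ω                       ≤⟨ leaf-arith n (deg G p) (deg G q) (deg G r) (deg G s) k l m
                                       (leaf-degrees pqrs s-leaf) (deg≤n G p) (deg≤n G q) (deg≤n G r) ⟩
      n * (8 + 7 * (k + (l + (m + 1)))) + 40
                                  ≤⟨ m≤m+n _ (Z₁ G a b c d + (Z₂ G a b c d + (Z₃ G a b c d + Z₄ G a b c d))) ⟩
      _ ∎
      where
      open ≤-Reasoning
      ω = deg G p * (1 + k) + (deg G q * (1 + l) + (deg G r * (1 + m) + deg G s * (1 + 1)))
    by-shape : Shape G a b c d →
      5 * (wa + (wb + (wc + wd))) + 4 * Z₅ G a b c d ≤
      n * (8 + 7 * (α + (β + (γ + η)))) + 40 +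
      (Z₁ G a b c d + (Z₂ G a b c d + (Z₃ G a b c d + Z₄ G a b c d)))
    by-shape (leaf₁ l) = from-leaf β γ η bcda l
      (λ _ (_ , ax , bx , cx , dx) → leaf∉K5 bcda l bx cx dx ax) (cong 𝟙 l)
      (first-last wa wb wc wd) (first-last α β γ η)
      where bcda = swap₃₄ G (swap₂₃ G (swap₁₂ G abcd))
    by-shape (leaf₂ l) = from-leaf α γ η acdb l
      (λ _ (_ , ax , bx , cx , dx) → leaf∉K5 acdb l ax cx dx bx) (cong 𝟙 l)
      (second-last wa wb wc wd) (second-last α β γ η)
      where acdb = swap₃₄ G (swap₂₃ G abcd)
    by-shape (leaf₃ l) = from-leaf α β η abdc l
      (λ _ (_ , ax , bx , cx , dx) → leaf∉K5 abdc l ax bx dx cx) (cong 𝟙 l)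
      (swap-last wa wb wc wd) (swap-last α β γ η)
      where abdc = swap₃₄ G abcd
    by-shape (leaf₄ l) = from-leaf α β γ abcd l
      (λ _ (_ , ax , bx , cx , dx) → leaf∉K5 abcd l ax bx cx dx) (cong 𝟙 l) refl refl
    by-shape (inK5 x k) = subst₂ (λ z zs → 5 * (wa + (wb + (wc + wd))) + 4 * z ≤ n * (8 + 7 * (α + (β + (γ + η)))) + 40 + zs)
      (sym (K5⇒∑≡ (deg G) k))
      (sym (cong₂ _+_ (K5⇒∑≡ (λ _ → deg G a) k) (cong₂ _+_ (K5⇒∑≡ (λ _ → deg G b) k)
        (cong₂ _+_ (K5⇒∑≡ (λ _ → deg G c) k) (K5⇒∑≡ (λ _ → deg G d) k)))))
      (K5-arith n (deg G a) (deg G b) (deg G c) (deg G d) (deg G x) α β γ η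
        (K5-degrees k) (deg≤n G a) (deg≤n G b) (deg≤n G c) (deg≤n G d))

  -- Double counting for the upper bound.

  private
    module W = Symmetrize G (weight G)
    module Λ = Symmetrize G (𝟙leaf G)
    M Ω Λ₁ Z : ℕ
    M = K4-tuples G
    Ω = ∑₄ W.first
    Λ₁ = ∑₄ Λ.first
    Z = ∑₄ (Z₅ G)

  -- Sum the shares that the K₄'s at `a` get from their three edges at `a`: at least 3 each, and 9
  -- if `a` is the leaf. The three edges contribute equally by symmetry, and every edge hands out at
  -- most 6.
  K4s-at-bound : ∀ a → K4s-at G a + 2 * leaves-at G a ≤ 6 * deg G a
  K4s-at-bound a = *-cancelˡ-≤ 3 (begin
    3 * (K4s-at G a + 2 * leaves-at G a)
      ≡⟨ eq₁ (K4s-at G a) (leaves-at G a) ⟩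
    3 * K4s-at G a + 6 * leaves-at G a
      ≡⟨ cong₂ _+_ (∑₃-*ˡ 3 (𝟙K4 G a)) (∑₃-*ˡ 6 (λ b c d → 𝟙K4 G a b c d * 𝟙leaf G a b c d)) ⟨
    ∑₃ (λ b c d → 3 * 𝟙K4 G a b c d) + ∑₃ (λ b c d → 6 * (𝟙K4 G a b c d * 𝟙leaf G a b c d))
      ≡⟨ ∑₃-+ _ _ ⟨
    ∑₃ (λ b c d → 3 * 𝟙K4 G a b c d + 6 * (𝟙K4 G a b c d * 𝟙leaf G a b c d))
      ≤⟨ ∑₃-mono pointwise ⟩
    ∑₃ (λ b c d → S b c d + S′ b c d + S″ b c d)
      ≡⟨ trans (∑₃-+ _ S″) (cong (_+ ∑₃ S″) (∑₃-+ S S′)) ⟩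
    ∑₃ S + ∑₃ S′ + ∑₃ S″
      ≡⟨ cong₂ (λ x y → ∑₃ S + x + y) S′≡S (trans S″≡S′ S′≡S) ⟩
    ∑₃ S + ∑₃ S + ∑₃ S
      ≡⟨ eq₂ (∑₃ S) ⟩
    3 * ∑₃ S
      ≤⟨ *-monoʳ-≤ 3 S-bound ⟩
    3 * (6 * deg G a) ∎)
    where
    open ≤-Reasoning
    S S′ S″ : Fin n → Fin n → Fin n → ℕ
    S  b c d = 𝟙K4 G a b c d * edge-share G a b
    S′ b c d = 𝟙K4 G a b c d * edge-share G a c
    S″ b c d = 𝟙K4 G a b c d * edge-share G a d
    eq₁ : ∀ P Q → 3 * (P + 2 * Q) ≡ 3 * P + 6 * Q
    eq₁ = solve-∀
    eq₂ : ∀ s → s + s + s ≡ 3 * s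
    eq₂ = solve-∀
    pointwise : ∀ b c d → 3 * 𝟙K4 G a b c d + 6 * (𝟙K4 G a b c d * 𝟙leaf G a b c d) ≤ S b c d + S′ b c d + S″ b c d
    pointwise b c d = by-K4 _ refl
      where
      eq₃ : ∀ l → 3 + 6 * l ≡ 3 + 6 * (1 * l)
      eq₃ = solve-∀
      eq₄ : ∀ x y z → x + y + z ≡ 1 * x + 1 * y + 1 * z
      eq₄ = solve-∀
      by-K4 : ∀ e → k4 G a b c d ≡ e → 3 * 𝟙 e + 6 * (𝟙 e * 𝟙leaf G a b c d) ≤
        𝟙 e * edge-share G a b + 𝟙 e * edge-share G a c + 𝟙 e * edge-share G a d
      by-K4 false _    = z≤n
      by-K4 true  abcd = subst₂ _≤_ (eq₃ (𝟙leaf G a b c d)) (eq₄ (edge-share G a b) (edge-share G a c) (edge-share G a d))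
        (edge-shares-bound (k4⇒IsK4 G abcd))
    S′≡S : ∑₃ S′ ≡ ∑₃ S
    S′≡S = trans (∑-swap (λ b c → ∑ λ d → S′ b c d)) (∑₃-cong λ b c d → cong (_* edge-share G a b) (𝟙K4-swap₂₃ G a c b d))
    S″≡S′ : ∑₃ S″ ≡ ∑₃ S′
    S″≡S′ = ∑-cong λ b → trans (∑-swap (λ c d → S″ b c d))
      (∑-cong λ c → ∑-cong λ d → cong (_* edge-share G a c) (𝟙K4-swap₃₄ G a b d c))
    S-bound : ∑₃ S ≤ 6 * deg G a
    S-bound = begin
      ∑₃ S
        ≡⟨ ∑-cong (λ b → trans (∑-cong λ c → ∑-*ʳ (𝟙K4 G a b c) (edge-share G a b)) (∑-*ʳ _ (edge-share G a b))) ⟩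
      ∑ (λ b → K4-count G a b * edge-share G a b)
        ≤⟨ ∑-mono (K4-count≤6*adj G a) ⟩
      ∑ (λ b → 6 * 𝟙 (adj G a b))
        ≡⟨ ∑-*ˡ 6 _ ⟩
      6 * deg G a ∎

  -- This is `vertex-arith` summed over all vertices, which turns n² into n³. `K4-tuples` unfolds to
  -- the sum of `K4s-at`.
  leaf-weighted-bound :
    2 * (n * (5 * K4-tuples G + 7 * ∑₄ (λ a b c d → 𝟙K4 G a b c d * 𝟙leaf G a b c d))) ≤
    10 * ∑₄ W.first + 15 * (n * (n * n))
  leaf-weighted-bound = begin
    2 * (n * (5 * ∑ (K4s-at G) + 7 * ∑ (leaves-at G)))
      ≡⟨ cong (λ x → 2 * (n * x)) (trans (∑-+ _ _) (cong₂ _+_ (∑-*ˡ 5 (K4s-at G)) (∑-*ˡ 7 (leaves-at G)))) ⟨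
    2 * (n * ∑ (λ a → 5 * K4s-at G a + 7 * leaves-at G a))
      ≡⟨ trans (∑-*ˡ 2 _) (cong (2 *_) (∑-*ˡ n _)) ⟨
    ∑ (λ a → 2 * (n * (5 * K4s-at G a + 7 * leaves-at G a)))
      ≤⟨ ∑-mono (λ a → vertex-arith n (deg G a) (K4s-at G a) (leaves-at G a) (K4s-at-bound a)) ⟩
    ∑ (λ a → 10 * (deg G a * (K4s-at G a + leaves-at G a)) + 15 * (n * n))
      ≡⟨ ∑-+ _ _ ⟩
    ∑ (λ a → 10 * (deg G a * (K4s-at G a + leaves-at G a))) + ∑ {n} (λ _ → 15 * (n * n))
      ≡⟨ cong₂ _+_ (trans (∑-*ˡ 10 _) (cong (10 *_) (∑-cong weigh))) (trans (∑-const n _) (eq n)) ⟩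
    10 * ∑₄ W.first + 15 * (n * (n * n)) ∎
    where
    open ≤-Reasoning
    eq : ∀ n → n * (15 * (n * n)) ≡ 15 * (n * (n * n))
    eq = solve-∀
    weigh : ∀ a → deg G a * (K4s-at G a + leaves-at G a) ≡ ∑₃ (W.first a)
    weigh a = trans (cong (deg G a *_) (sym (∑₃-+ (𝟙K4 G a) _)))
      (trans (sym (∑₃-*ˡ (deg G a) _)) (∑₃-cong λ b c d → eq′ (deg G a) (𝟙K4 G a b c d) (𝟙leaf G a b c d)))
      where
      eq′ : ∀ d i l → d * (i + i * l) ≡ i * (d * (1 + l))
      eq′ = solve-∀

  private
    Weighted : Set
    Weighted = List (ℕ × (Fin n → Fin n → Fin n → Fin n → ℕ))

    -- The two sides of `weight-bound` multiplied out. Every term carries the K₄ indicator, except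
    -- the `Z`'s, which contain the K₅ indicator.
    lhs rhs : Weighted
    lhs = (5 , W.first) ∷ (5 , W.second) ∷ (5 , W.third) ∷ (5 , W.fourth) ∷ (4 , Z₅ G) ∷ []
    rhs = (8 * n , 𝟙K4 G) ∷ (7 * n , Λ.first) ∷ (7 * n , Λ.second) ∷ (7 * n , Λ.third) ∷ (7 * n , Λ.fourth) ∷
      (40 , 𝟙K4 G) ∷ (1 , Z₁ G) ∷ (1 , Z₂ G) ∷ (1 , Z₃ G) ∷ (1 , Z₄ G) ∷ []

    at : Weighted → Fin n → Fin n → Fin n → Fin n → ℕ
    at fs a b c d = List.sum (map (λ kf → proj₁ kf * proj₂ kf a b c d) fs)

    lhs≤rhs : ∀ a b c d → at lhs a b c d ≤ at rhs a b c d
    lhs≤rhs a b c d = by-K4 _ refl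
      where
      eqˡ : ∀ p q r s z → 5 * (p + (q + (r + s))) + 4 * z ≡
        5 * (1 * p) + (5 * (1 * q) + (5 * (1 * r) + (5 * (1 * s) + (4 * z + 0))))
      eqˡ = solve-∀
      eqʳ : ∀ n p q r s z₁ z₂ z₃ z₄ → n * (8 + 7 * (p + (q + (r + s)))) + 40 + (z₁ + (z₂ + (z₃ + z₄))) ≡
        8 * n * 1 + (7 * n * (1 * p) + (7 * n * (1 * q) + (7 * n * (1 * r) + (7 * n * (1 * s) +
        (40 * 1 + (1 * z₁ + (1 * z₂ + (1 * z₃ + (1 * z₄ + 0)))))))))
      eqʳ = solve-∀
      by-K4 : ∀ e → k4 G a b c d ≡ e →
        5 * (𝟙 e * weight G a b c d) + (5 * (𝟙 e * weight G b a c d) +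
        (5 * (𝟙 e * weight G c a b d) + (5 * (𝟙 e * weight G d a b c) + (4 * Z₅ G a b c d + 0)))) ≤
        8 * n * 𝟙 e + (7 * n * (𝟙 e * 𝟙leaf G a b c d) + (7 * n * (𝟙 e * 𝟙leaf G b a c d) +
        (7 * n * (𝟙 e * 𝟙leaf G c a b d) + (7 * n * (𝟙 e * 𝟙leaf G d a b c) +
        (40 * 𝟙 e + (1 * Z₁ G a b c d + (1 * Z₂ G a b c d + (1 * Z₃ G a b c d + (1 * Z₄ G a b c d + 0)))))))))
      by-K4 true abcd = subst₂ _≤_
        (eqˡ (weight G a b c d) (weight G b a c d) (weight G c a b d) (weight G d a b c) (Z₅ G a b c d))
        (eqʳ n (𝟙leaf G a b c d) (𝟙leaf G b a c d) (𝟙leaf G c a b d) (𝟙leaf G d a b c)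
          (Z₁ G a b c d) (Z₂ G a b c d) (Z₃ G a b c d) (Z₄ G a b c d))
        (weight-bound (k4⇒IsK4 G abcd))
      -- Where `abcd` is not a K₄, only `Z₅` is left on the left side, and it vanishes because a K₅
      -- would contain that K₄.
      by-K4 false ¬abcd = ≤-trans (≤-reflexive (cong (λ z → 4 * z + 0) (no-K5⇒∑≡0 G (deg G) λ x k5 →
        contradiction (trans (sym (IsK4⇒k4 G (proj₁ k5))) ¬abcd) λ ()))) z≤n

    sum-lhs : ∑₄ (at lhs) ≡ 20 * Ω + 4 * Z
    sum-lhs = trans (∑₄-linear lhs) (eq (∑₄ W.second) (∑₄ W.third) (∑₄ W.fourth) W.∑-second W.∑-third W.∑-fourth)
      where
      ring-eq : ∀ Ω Z → 5 * Ω + (5 * Ω + (5 * Ω + (5 * Ω + (4 * Z + 0)))) ≡ 20 * Ω + 4 * Z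
      ring-eq = solve-∀
      eq : ∀ p q r → p ≡ Ω → q ≡ Ω → r ≡ Ω → 5 * Ω + (5 * p + (5 * q + (5 * r + (4 * Z + 0)))) ≡ 20 * Ω + 4 * Z
      eq _ _ _ refl refl refl = ring-eq Ω Z

    sum-rhs : ∑₄ (at rhs) ≡ n * (8 * M + 28 * Λ₁) + 40 * M + 4 * Z
    sum-rhs = trans (∑₄-linear rhs)
      (eq Λ.∑-second Λ.∑-third Λ.∑-fourth (∑Z₁ G) (∑Z₂ G) (∑Z₃ G) (∑Z₄ G))
      where
      ring-eq : ∀ n M l Z → 8 * n * M + (7 * n * l + (7 * n * l + (7 * n * l + (7 * n * l +
        (40 * M + (1 * Z + (1 * Z + (1 * Z + (1 * Z + 0))))))))) ≡ n * (8 * M + 28 * l) + 40 * M + 4 * Z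
      ring-eq = solve-∀
      eq : ∀ {l₂ l₃ l₄ z₁ z₂ z₃ z₄} → l₂ ≡ Λ₁ → l₃ ≡ Λ₁ → l₄ ≡ Λ₁ → z₁ ≡ Z → z₂ ≡ Z → z₃ ≡ Z → z₄ ≡ Z →
        8 * n * M + (7 * n * Λ₁ + (7 * n * l₂ + (7 * n * l₃ + (7 * n * l₄ +
        (40 * M + (1 * z₁ + (1 * z₂ + (1 * z₃ + (1 * z₄ + 0))))))))) ≡ n * (8 * M + 28 * Λ₁) + 40 * M + 4 * Z
      eq refl refl refl refl refl refl refl = ring-eq n M Λ₁ Z

    -- The sums of all five `Z`'s agree, so `4 * Z` stands on both sides and cancels.
    weights-above : 20 * Ω ≤ n * (8 * M + 28 * Λ₁) + 40 * M
    weights-above = +-cancelʳ-≤ (4 * Z) _ _ (subst₂ _≤_ sum-lhs sum-rhs (∑₄-mono lhs≤rhs))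

  numK4-bound : 80 ≤ n → 9 * numK4 G ≤ n * n
  numK4-bound 80≤n = numK4-arith n M (numK4 G) 80≤n
    (combine-bounds n M Λ₁ Ω leaf-weighted-bound weights-above)
    (24*numK4≤K4-tuples G)

-- The lower bound construction.

-- The complete join of t disjoint triangles with r independent vertices.
module _ (t r : ℕ) where

  private
    Vertex : Set
    Vertex = Fin (t * 3) ⊎ Fin r

    side : Fin (t * 3 + r) → Vertex
    side = splitAt (t * 3)

    -- `quotient 3` cuts `Fin (t * 3)` into `t` blocks of three, and each block is a triangle.
    adjacent : Vertex → Vertex → Bool
    adjacent (inj₁ p) (inj₁ q) = does (quotient 3 p ≟ quotient {t} 3 q) ∧ not (does (p ≟ q))
    adjacent (inj₁ _) (inj₂ _) = true
    adjacent (inj₂ _) (inj₁ _) = true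
    adjacent (inj₂ _) (inj₂ _) = false

    ≟-sym : ∀ {n} (i j : Fin n) → does (i ≟ j) ≡ does (j ≟ i)
    ≟-sym i j = true⇔⇒≡ (λ h → dec-true (j ≟ i) (sym (does⇒ (i ≟ j) h)))
      (λ h → dec-true (i ≟ j) (sym (does⇒ (j ≟ i) h)))

    adjacent-sym : ∀ u v → adjacent u v ≡ adjacent v u
    adjacent-sym (inj₁ p) (inj₁ q) = cong₂ (λ x y → x ∧ not y) (≟-sym (quotient {t} 3 p) (quotient 3 q)) (≟-sym p q)
    adjacent-sym (inj₁ _) (inj₂ _) = refl
    adjacent-sym (inj₂ _) (inj₁ _) = refl
    adjacent-sym (inj₂ _) (inj₂ _) = refl

    adjacent-irrefl : ∀ u → adjacent u u ≡ false
    adjacent-irrefl (inj₁ p) rewrite dec-true (p ≟ p) refl = ∧-comm _ false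
    adjacent-irrefl (inj₂ _) = refl

  triangle-join : Graph (t * 3 + r)
  triangle-join = record
    { adj    = λ i j → adjacent (side i) (side j)
    ; sym    = λ i j → adjacent-sym (side i) (side j)
    ; irrefl = λ i → adjacent-irrefl (side i)
    }

  private
    G = triangle-join

    same-triangle : ∀ {i j p q} → Edge G i j → side i ≡ inj₁ p → side j ≡ inj₁ q → quotient {t} 3 p ≡ quotient 3 q
    same-triangle {p = p} {q} ij i≡ j≡ rewrite i≡ | j≡ with quotient {t} 3 p ≟ quotient 3 q
    ... | yes e = e

    InTriangle : Fin (t * 3 + r) → Set
    InTriangle i = ∃ λ p → side i ≡ inj₁ p

    classify : ∀ i → InTriangle i ⊎ (∃ λ s → side i ≡ inj₂ s)
    classify i with side i
    ... | inj₁ p = inj₁ (p , refl)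
    ... | inj₂ s = inj₂ (s , refl)

    independent : ∀ {i j u v} → Edge G i j → side i ≡ inj₂ u → side j ≡ inj₂ v → ⊥
    independent ij i≡ j≡ rewrite i≡ | j≡ with () ← ij

    opposite : ∀ {i j s} → Edge G i j → side i ≡ inj₂ s → InTriangle j
    opposite {j = j} ij i≡ with classify j
    ... | inj₁ j∈       = j∈
    ... | inj₂ (_ , j≡) = ⊥-elim (independent ij i≡ j≡)

    one-in-triangle : ∀ {i j} → Edge G i j → InTriangle i ⊎ InTriangle j
    one-in-triangle {i} ij with classify i
    ... | inj₁ i∈       = inj₁ i∈
    ... | inj₂ (_ , i≡) = inj₂ (opposite ij i≡)

    -- The edges at `i` put all four vertices into one triangle, and two of four remainders modulo 3
    -- coincide.
    no-four : ∀ {i j k l} → InTriangle i → InTriangle j → InTriangle k → InTriangle l →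
      Edge G i j → Edge G i k → Edge G i l → j ≢ k → j ≢ l → k ≢ l → ⊥
    no-four {i} {j} {k} {l} (p , i≡) (q , j≡) (u , k≡) (v , l≡) ij ik il j≢k j≢l k≢l
      with x , y , x<y , e ← pigeonhole (n<1+n 3) (remainder {t} 3 ∘ lookup (p ∷ q ∷ u ∷ v ∷ [])) =
      <⇒≢ x<y (cong toℕ (lookup-injective distinct x y (begin
        lookup ps x                       ≡⟨ combine-remQuot {t} 3 (lookup ps x) ⟨
        combine (quotient {t} 3 (lookup ps x)) (remainder {t} 3 (lookup ps x))
          ≡⟨ cong₂ combine (trans (quotient≡ x) (sym (quotient≡ y))) e ⟩
        combine (quotient {t} 3 (lookup ps y)) (remainder {t} 3 (lookup ps y))
          ≡⟨ combine-remQuot {t} 3 (lookup ps y) ⟩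
        lookup ps y                       ∎)))
      where
      open ≡-Reasoning
      ps = p ∷ q ∷ u ∷ v ∷ []
      lift : ∀ {i j p q} → side i ≡ inj₁ p → side j ≡ inj₁ q → i ≢ j → p ≢ q
      lift i≡ j≡ i≢j refl = i≢j (trans (sym (splitAt⁻¹-↑ˡ i≡)) (splitAt⁻¹-↑ˡ j≡))
      distinct = (lift i≡ j≡ (edge⇒≢ G {i} ij) ∷ lift i≡ k≡ (edge⇒≢ G {i} ik) ∷ lift i≡ l≡ (edge⇒≢ G {i} il) ∷ [])
               ∷ (lift j≡ k≡ j≢k ∷ lift j≡ l≡ j≢l ∷ []) ∷ (lift k≡ l≡ k≢l ∷ []) ∷ [] ∷ []
      quotient≡ : ∀ x → quotient {t} 3 (lookup ps x) ≡ quotient {t} 3 p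
      quotient≡ zero                   = refl
      quotient≡ (suc zero)             = sym (same-triangle {i} {j} ij i≡ j≡)
      quotient≡ (suc (suc zero))       = sym (same-triangle {i} {k} ik i≡ k≡)
      quotient≡ (suc (suc (suc zero))) = sym (same-triangle {i} {l} il i≡ l≡)

  -- If `a` or `b` is independent, the other one and `c`, `d`, `e` all lie in one triangle. If
  -- neither is, the edges `cd` and `ef` each have an endpoint outside the independent set, and
  -- these two share a triangle with `a` and `b`.
  triangle-join-free : B42Free G
  triangle-join-free (f , f-inj , (ab , ac , ad , bc , bd , cd) , (_ , ae , af , be , bf , ef)) =
    by-sides (classify a) (classify b)
    where
    a = f zero
    b = f (suc zero)
    c = f (suc (suc zero))
    d = f (suc (suc (suc zero)))
    e = f (suc (suc (suc (suc zero))))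
    g = f (suc (suc (suc (suc (suc zero)))))
    ba : Edge G b a
    ba = edge-sym G {a} ab
    a≢b : a ≢ b
    a≢b = edge⇒≢ G {a} ab
    by-sides : InTriangle a ⊎ (∃ λ s → side a ≡ inj₂ s) → InTriangle b ⊎ (∃ λ s → side b ≡ inj₂ s) → ⊥
    by-sides (inj₂ (_ , a≡)) _ =
      no-four {b} {c} {d} {e} (opposite {a} ab a≡) (opposite {a} ac a≡) (opposite {a} ad a≡) (opposite {a} ae a≡)
        bc bd be (edge⇒≢ G {c} cd) (λ x → case f-inj x of λ ()) (λ x → case f-inj x of λ ())
    by-sides (inj₁ _) (inj₂ (_ , b≡)) =
      no-four {a} {c} {d} {e} (opposite {b} ba b≡) (opposite {b} bc b≡) (opposite {b} bd b≡) (opposite {b} be b≡)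
        ac ad ae (edge⇒≢ G {c} cd) (λ x → case f-inj x of λ ()) (λ x → case f-inj x of λ ())
    by-sides (inj₁ a∈) (inj₁ b∈) with one-in-triangle {c} cd | one-in-triangle {e} ef
    ... | inj₁ c∈ | inj₁ e∈ = no-four {a} {b} {c} {e} a∈ b∈ c∈ e∈ ab ac ae (edge⇒≢ G {b} bc) (edge⇒≢ G {b} be) λ x → case f-inj x of λ ()
    ... | inj₁ c∈ | inj₂ g∈ = no-four {a} {b} {c} {g} a∈ b∈ c∈ g∈ ab ac af (edge⇒≢ G {b} bc) (edge⇒≢ G {b} bf) λ x → case f-inj x of λ ()
    ... | inj₂ d∈ | inj₁ e∈ = no-four {a} {b} {d} {e} a∈ b∈ d∈ e∈ ab ad ae (edge⇒≢ G {b} bd) (edge⇒≢ G {b} be) λ x → case f-inj x of λ ()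
    ... | inj₂ d∈ | inj₂ g∈ = no-four {a} {b} {d} {g} a∈ b∈ d∈ g∈ ab ad af (edge⇒≢ G {b} bd) (edge⇒≢ G {b} bf) λ x → case f-inj x of λ ()

  -- Each triangle with each independent vertex gives one sorted tuple, since the apex is numbered
  -- after all corners. The chain then frees `d`, `c`, `b` and `a` in turn.
  t*r≤numK4 : t * r ≤ numK4 G
  t*r≤numK4 = begin
    t * r
      ≡⟨ trans (∑-const t _) (cong (t *_) (trans (∑-const r 1) (*-identityʳ r))) ⟨
    ∑ {t} (λ q → ∑ {r} λ s → 1)
      ≡⟨ ∑-cong (λ q → ∑-cong λ s → cong 𝟙 (tetrahedron q s)) ⟨
    ∑ (λ q → ∑ λ s → h (corner 0F q) (corner 1F q) (corner 2F q) (apex s))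
      ≤⟨ ∑-mono (λ q → ∑-injective apex (↑ʳ-injective (t * 3) _ _) (h (corner 0F q) (corner 1F q) (corner 2F q))) ⟩
    ∑ (λ q → ∑ λ d → h (corner 0F q) (corner 1F q) (corner 2F q) d)
      ≤⟨ ∑-mono (λ q → term≤∑ (λ c → ∑ λ d → h (corner 0F q) (corner 1F q) c d) (corner 2F q)) ⟩
    ∑ (λ q → ∑ λ c → ∑ λ d → h (corner 0F q) (corner 1F q) c d)
      ≤⟨ ∑-mono (λ q → term≤∑ (λ b → ∑ λ c → ∑ λ d → h (corner 0F q) b c d) (corner 1F q)) ⟩
    ∑ (λ q → ∑ λ b → ∑ λ c → ∑ λ d → h (corner 0F q) b c d)
      ≤⟨ ∑-injective (corner 0F) (λ {i} {j} e → combine-injectiveˡ i 0F j 0F (↑ˡ-injective r _ _ e))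
           (λ a → ∑ λ b → ∑ λ c → ∑ λ d → h a b c d) ⟩
    ∑₄ h
      ≡⟨ numK4≡∑₄ G ⟨
    numK4 G ∎
    where
    open ≤-Reasoning
    h : Fin (t * 3 + r) → Fin (t * 3 + r) → Fin (t * 3 + r) → Fin (t * 3 + r) → ℕ
    h a b c d = 𝟙 (k4ᵇ G a b c d)
    corner : Fin 3 → Fin t → Fin (t * 3 + r)
    corner k q = combine q k ↑ˡ r
    apex : Fin r → Fin (t * 3 + r)
    apex s = (t * 3) ↑ʳ s
    corner-edge : ∀ q k l → k ≢ l → Edge G (corner k q) (corner l q)
    corner-edge q k l k≢l
      rewrite splitAt-↑ˡ (t * 3) (combine q k) r | splitAt-↑ˡ (t * 3) (combine q l) r =
      ∧-true (dec-true (_ ≟ _) (trans (cong proj₁ (remQuot-combine q k)) (sym (cong proj₁ (remQuot-combine q l)))))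
             (cong not (dec-false (combine q k ≟ combine q l) (k≢l ∘ combine-injectiveʳ q k q l)))
    apex-edge : ∀ q k s → Edge G (corner k q) (apex s)
    apex-edge q k s rewrite splitAt-↑ˡ (t * 3) (combine q k) r | splitAt-↑ʳ (t * 3) r s = refl
    corner-< : ∀ q {k l} → toℕ k < toℕ l → toℕ (corner k q) < toℕ (corner l q)
    corner-< q {k} {l} k<l
      rewrite toℕ-↑ˡ (combine q k) r | toℕ-↑ˡ (combine q l) r | toℕ-combine q k | toℕ-combine q l =
      +-monoʳ-< (3 * toℕ q) k<l
    apex-> : ∀ q k s → toℕ (corner k q) < toℕ (apex s)
    apex-> q k s rewrite toℕ-↑ˡ (combine q k) r | toℕ-↑ʳ (t * 3) s =
      ≤-trans (toℕ<n (combine q k)) (m≤m+n (t * 3) (toℕ s))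
    tetrahedron : ∀ q s → k4ᵇ G (corner 0F q) (corner 1F q) (corner 2F q) (apex s) ≡ true
    tetrahedron q s =
      ∧-true (<⇒<ᵇ-true (corner-< q (s≤s z≤n)))
      (∧-true (<⇒<ᵇ-true (corner-< q (s≤s (s≤s z≤n))))
      (∧-true (<⇒<ᵇ-true (apex-> q 2F s))
      (IsK4⇒k4 G {corner 0F q} {corner 1F q} {corner 2F q} {apex s}
        ( corner-edge q 0F 1F (λ ()) , corner-edge q 0F 2F (λ ()) , apex-edge q 0F s
        , corner-edge q 1F 2F (λ ()) , apex-edge q 1F s , apex-edge q 2F s))))

-- Since (3t + r)² = 12 t r + (r - 3t)², the best `r` is close to 3t. For n = 6m + j with j ≤ 4,
-- taking t = m leaves the error j² ≤ 16.
many-K4s : ∀ n → Σ (Graph n) λ G → B42Free G × n * n ≤ 12 * numK4 G + 24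
many-K4s n = subst (λ n → Σ (Graph n) λ G → B42Free G × n * n ≤ 12 * numK4 G + 24)
  (sym (m≡m%n+[m/n]*n n 6)) (split (n / 6) (n % 6) (m%n<n n 6))
  where
  build : ∀ t r {m} → t * 3 + r ≡ m → (t * 3 + r) * (t * 3 + r) ≤ 12 * (t * r) + 24 →
    Σ (Graph m) λ G → B42Free G × m * m ≤ 12 * numK4 G + 24
  build t r refl h = triangle-join t r , triangle-join-free t r ,
    ≤-trans h (+-monoˡ-≤ 24 (*-monoʳ-≤ 12 (t*r≤numK4 t r)))
  low : ∀ m j → j * j ≤ 24 → Σ (Graph (j + m * 6)) λ G → B42Free G × (j + m * 6) * (j + m * 6) ≤ 12 * numK4 G + 24
  low m j j²≤24 = build m (3 * m + j) (eq₁ m j) (≤-trans (≤-reflexive (eq₂ m j)) (+-monoʳ-≤ (12 * (m * (3 * m + j))) j²≤24))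
    where
    eq₁ : ∀ m j → m * 3 + (3 * m + j) ≡ j + m * 6
    eq₁ = solve-∀
    eq₂ : ∀ m j → (m * 3 + (3 * m + j)) * (m * 3 + (3 * m + j)) ≡ 12 * (m * (3 * m + j)) + j * j
    eq₂ = solve-∀
  -- For remainder 5 the square 25 would exceed 24; `suc m` triangles and `3 * m + 2` independent
  -- vertices leave an error of 1.
  high : ∀ m → Σ (Graph (5 + m * 6)) λ G → B42Free G × (5 + m * 6) * (5 + m * 6) ≤ 12 * numK4 G + 24
  high m = build (suc m) (3 * m + 2) (eq₁ m) (≤-trans (≤-reflexive (eq₂ m)) (+-monoʳ-≤ (12 * (suc m * (3 * m + 2))) (s≤s z≤n)))
    where
    eq₁ : ∀ m → (1 + m) * 3 + (3 * m + 2) ≡ 5 + m * 6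
    eq₁ = solve-∀
    eq₂ : ∀ m → ((1 + m) * 3 + (3 * m + 2)) * ((1 + m) * 3 + (3 * m + 2)) ≡ 12 * ((1 + m) * (3 * m + 2)) + 1
    eq₂ = solve-∀
  split : ∀ m j → j < 6 → Σ (Graph (j + m * 6)) λ G → B42Free G × (j + m * 6) * (j + m * 6) ≤ 12 * numK4 G + 24
  split m 0 _ = low m 0 (≤ᵇ⇒≤ _ _ _)
  split m 1 _ = low m 1 (≤ᵇ⇒≤ _ _ _)
  split m 2 _ = low m 2 (≤ᵇ⇒≤ _ _ _)
  split m 3 _ = low m 3 (≤ᵇ⇒≤ _ _ _)
  split m 4 _ = low m 4 (≤ᵇ⇒≤ _ _ _)
  split m 5 _ = high m
  split m (suc (suc (suc (suc (suc (suc _)))))) (s≤s (s≤s (s≤s (s≤s (s≤s (s≤s ()))))))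

theorem1p7 : (Σ ℕ λ N → ∀ n → N ≤ n →
    Σ (Graph n) λ G → B42Free G × n * n ≤ 12 * numK4 G + 24)
    ×
    (∀ k → Σ ℕ λ N → ∀ n → N ≤ n → ∀ (G : Graph n) → B42Free G →
    9 * suc k * numK4 G ≤ suc k * (n * n) + 9 * (n * n))
-- The o(n²) term is read as n² / (k + 1) for every `k`. The bound of `numK4-bound` has no error
-- term, so the threshold 80 serves all `k`.
theorem1p7 = (0 , λ n _ → many-K4s n) , λ k → 80 , λ n 80≤n G free → begin
  9 * suc k * numK4 G                ≡⟨ eq (suc k) (numK4 G) ⟩
  suc k * (9 * numK4 G)              ≤⟨ *-monoʳ-≤ (suc k) (numK4-bound G free 80≤n) ⟩
  suc k * (n * n)                    ≤⟨ m≤m+n (suc k * (n * n)) (9 * (n * n)) ⟩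
  suc k * (n * n) + 9 * (n * n)      ∎
  where
  open ≤-Reasoning
  eq : ∀ k T → 9 * k * T ≡ k * (9 * T)
  eq = solve-∀
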